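{- For every $n\ge1$, $H_n(x,y)=H_{2,n}+3H_{1,n}+H_{0,n}$, where $H_{2,n},H_{1,n},H_{0,n}\in\mathbb{Z}[x,y]$ satisfy $H_{2,1}=y+2$, $H_{1,1}=x-1$, $H_{0,1}=(x-1)^2$ and, for $n\ge1$, writing $H_i$ for $H_{i,n}(x,y)$ (identities in $\mathbb{Q}(x,y)$): $$H_{2,n+1}=(y-1)H_2^3+\tfrac{1}{x-1}(6H_2^2H_1+3H_2H_1^2)+3H_2^3+6H_2^2H_1+3H_2H_1^2,$$ $$\begin{aligned}H_{1,n+1}={}&(y-1)H_2^2H_1+\tfrac1{x-1}(H_2^2H_0+7H_2H_1^2+2H_2H_1H_0+4H_1^3+H_1^2H_0)\\&+7H_2^2H_1+2H_2^2H_0+14H_2H_1^2+4H_2H_1H_0+7H_1^3+2H_1^2H_0\\&+(x-1)(H_2^3+5H_2^2H_1+H_2^2H_0+7H_2H_1^2+2H_2H_1H_0+3H_1^3+H_1^2H_0),\end{aligned}$$ $$\begin{aligned}H_{0,n+1}={}&(y-1)(3H_2H_1^2+H_1^3)+\tfrac1{x-1}(12H_2H_1H_0+3H_2H_0^2+14H_1^3+24H_1^2H_0+9H_1H_0^2+H_0^3)\\&+3H_2^2H_0+36H_2H_1^2+42H_2H_1H_0+9H_2H_0^2+60H_1^3+75H_1^2H_0+27H_1H_0^2+3H_0^3\\&+(x-1)(12H_2^2H_1+6H_2^2H_0+60H_2H_1^2+48H_2H_1H_0+9H_2H_0^2+72H_1^3+78H_1^2H_0+27H_1H_0^2+3H_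0^3)\\&+(x-1)^2(H_2^3+9H_2^2H_1+3H_2^2H_0+27H_2H_1^2+18H_2H_1H_0+3H_2H_0^2+27H_1^3+27H_1^2H_0+9H_1H_0^2+H_0^3).\end{aligned}$$
   Context: Graphs are finite; multiple edges are allowed. For a graph $G$, a spanning subgraph $A$ has vertex set $V(G)$ and edge set $E(A)\subseteq E(G)$; $k(A)$ is its number of components, $r(A)=|V(G)|-k(A)$, $n(A)=|E(A)|-r(A)$; the weight of $A$ is $(x-1)^{r(G)-r(A)}(y-1)^{n(A)}$ and the Tutte polynomial $T(G;x,y)$ is the sum of the weights of all spanning subgraphs. The graphs $\Sigma_n$ ($n\ge1$; the Schreier graphs of the Hanoi Towers group $H^{(3)}$ acting on the $n$-th level of the rooted ternary tree, with their three loops removed) each have three outmost vertices top, left, right: $\Sigma_1$ is the triangle $K_3$; $\Sigma_{n+1}$ is the disjoint union of three copies $G_1,G_2,G_3$ of $\Sigma_n$ together with three new edges (special edges) joining left$(G_1)$ to top$(G_2)$, right$(G_1)$ to top$(G_3)$, and right$(G_2)$ to left$(G_3)$; its outmost vertices are top$(G_1)$, left$(G_2)$, right$(G_3)$. Thus $|V(\Sigma_n)|=3^n$, $|E(\Sigma_n)|=(3^{n+1}-3)/2$. $H_n(x,y)=T(\Sigma_n;x,y)$. $H_{2,n}$ (resp. $H_{1,n}$, $H_{0,n}$) is the sum of the weights (with $G=\Sigma_n$) of the spanning subgraphs of $\Sigma_n$ in which the three outmost vertices lie in one component (resp. left and right outmost in one component and top in another; resp. the three in three distinct components). -}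

module Defs where

open import Algebra.Bundles using (CommutativeRing)
import Algebra.Consequences.Setoid as Consequences
import Algebra.Properties.Ring as RingProperties
import Algebra.Properties.Semiring.Exp as Exp
import Algebra.Properties.Semiring.Mult as Mult
import Algebra.Solver.Ring.NaturalCoefficients.Default as Solver
import Relation.Binary.Reasoning.Setoid as SetoidReasoning
open import Data.Empty using (⊥-elim)
open import Data.Fin.Base using (Fin; zero; suc; combine)
open import Data.Fin.Patterns using (0F; 1F; 2F)
open import Data.Fin.Properties using () renaming (_≟_ to _≟ᶠ_)
open import Data.Fin.Subset using (Subset; Side; inside; outside; ⊤; ∣_∣)
import Data.Fin.Subset as Subset
import Data.Integer.Base as ℤ
import Data.Integer.Properties as ℤₚ
open import Data.List.Base as List using (List; []; _∷_; foldr; filter; length; deduplicate; allFin)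
open import Data.Nat.Base as ℕ using (ℕ; zero; suc; NonZero; _∸_)
open import Data.Product.Base using (_×_; _,_; ∃; map)
open import Data.Sum.Base using (_⊎_; inj₁; inj₂; [_,_])
open import Data.Vec.Base as Vec using (Vec; []; _∷_; lookup; _++_; here; there)
open import Level using (_⊔_) renaming (suc to lsuc)
open import Relation.Binary.Bundles using (Setoid)
open import Relation.Binary.Construct.Closure.Equivalence as Eq using (EqClosure)
open import Relation.Binary.Construct.Closure.ReflexiveTransitive using (ε; _◅_; _◅◅_)
open import Relation.Binary.Construct.Closure.Symmetric using (fwd; bwd)
open import Relation.Binary.Definitions using (Decidable)
open import Relation.Binary.PropositionalEquality using (_≡_; refl)
open import Relation.Binary.Structures using (IsEquivalence)
open import Relation.Nullary using (¬_; Dec; yes; no; ¬?)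
open import Relation.Nullary.Decidable using (map′; _×-dec_; _⊎-dec_)

record IntegralDomain c ℓ : Set (lsuc (c ⊔ ℓ)) where
  field
    commutativeRing : CommutativeRing c ℓ
  open CommutativeRing commutativeRing public
  field
    1≉0  : ¬ 1# ≈ 0#
    ≈0?  : ∀ a → Dec (a ≈ 0#)
    *-≉0 : ∀ {a b} → ¬ a ≈ 0# → ¬ b ≈ 0# → ¬ a * b ≈ 0#

  open RingProperties ring public using (-0#≈0#; -‿distribˡ-*)

ℤ-domain : IntegralDomain _ _
ℤ-domain = record
  { commutativeRing = ℤₚ.+-*-commutativeRing
  ; 1≉0             = λ ()
  ; ≈0?             = λ i → i ℤₚ.≟ ℤ.0ℤ
  ; *-≉0            = λ {i} i≢0 j≢0 ij≡0 → [ i≢0 , j≢0 ] (ℤₚ.i*j≡0⇒i≡0∨j≡0 i ij≡0)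
  }

-- A polynomial is its list of coefficients, constant term first.  Trailing
-- zeros are permitted, so polynomials are compared coefficientwise.

module Polynomials {c ℓ} (R : IntegralDomain c ℓ) where
  private module R = IntegralDomain R

  Poly : Set c
  Poly = List R.Carrier

  coeff : Poly → ℕ → R.Carrier
  coeff []      _       = R.0#
  coeff (a ∷ p) zero    = a
  coeff (a ∷ p) (suc i) = coeff p i

  infix  4 _≈_
  infixl 6 _+_
  infixl 7 _*_ _∙_
  infix  8 -_

  record _≈_ (p q : Poly) : Set ℓ where
    constructor mk≈
    field at : ∀ i → coeff p i R.≈ coeff q i
  open _≈_ public

  _+_ : Poly → Poly → Poly
  []      + q       = q
  (a ∷ p) + []      = a ∷ p
  (a ∷ p) + (b ∷ q) = (a R.+ b) ∷ (p + q)

  -_ : Poly → Poly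
  -_ = List.map (λ a → R.- a)

  _∙_ : R.Carrier → Poly → Poly
  a ∙ p = List.map (a R.*_) p

  _*_ : Poly → Poly → Poly
  []      * q = []
  (a ∷ p) * q = (a ∙ q) + (R.0# ∷ p * q)

  const : R.Carrier → Poly
  const a = a ∷ []

  X : Poly
  X = R.0# ∷ R.1# ∷ []

  private
    coeff-+ : ∀ p q i → coeff (p + q) i R.≈ coeff p i R.+ coeff q i
    coeff-+ []      q       i       = R.sym (R.+-identityˡ _)
    coeff-+ (a ∷ p) []      i       = R.sym (R.+-identityʳ _)
    coeff-+ (a ∷ p) (b ∷ q) zero    = R.refl
    coeff-+ (a ∷ p) (b ∷ q) (suc i) = coeff-+ p q i

    coeff-neg : ∀ p i → coeff (- p) i R.≈ R.- coeff p i
    coeff-neg []      i       = R.sym R.-0#≈0#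
    coeff-neg (a ∷ p) zero    = R.refl
    coeff-neg (a ∷ p) (suc i) = coeff-neg p i

    coeff-∙ : ∀ a p i → coeff (a ∙ p) i R.≈ a R.* coeff p i
    coeff-∙ a []      i       = R.sym (R.zeroʳ a)
    coeff-∙ a (b ∷ p) zero    = R.refl
    coeff-∙ a (b ∷ p) (suc i) = coeff-∙ a p i

    ≈-refl : ∀ {p} → p ≈ p
    ≈-refl = mk≈ λ i → R.refl

    ≈-sym : ∀ {p q} → p ≈ q → q ≈ p
    ≈-sym e = mk≈ λ i → R.sym (at e i)

    ≈-trans : ∀ {p q r} → p ≈ q → q ≈ r → p ≈ r
    ≈-trans e f = mk≈ λ i → R.trans (at e i) (at f i)

    ∷-cong : ∀ {a b p q} → a R.≈ b → p ≈ q → (a ∷ p) ≈ (b ∷ q)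
    ∷-cong e f = mk≈ λ { zero → e ; (suc i) → at f i }

    0∷[] : (R.0# ∷ []) ≈ []
    0∷[] = mk≈ λ { zero → R.refl ; (suc i) → R.refl }

    head-≈ : ∀ {a b p q} → (a ∷ p) ≈ (b ∷ q) → a R.≈ b
    head-≈ e = at e zero

    tail-≈ : ∀ {a b p q} → (a ∷ p) ≈ (b ∷ q) → p ≈ q
    tail-≈ e = mk≈ λ i → at e (suc i)

    tail-≈[] : ∀ {a p} → (a ∷ p) ≈ [] → p ≈ []
    tail-≈[] e = mk≈ λ i → at e (suc i)

    +-cong : ∀ {p q r s} → p ≈ q → r ≈ s → p + r ≈ q + s
    +-cong {p} {q} {r} {s} e f = mk≈ λ i →
      R.trans (coeff-+ p r i) (R.trans (R.+-cong (at e i) (at f i)) (R.sym (coeff-+ q s i)))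

    +-assoc : ∀ p q r → (p + q) + r ≈ p + (q + r)
    +-assoc p q r = mk≈ λ i → begin
      coeff ((p + q) + r) i                      ≈⟨ coeff-+ (p + q) r i ⟩
      coeff (p + q) i R.+ coeff r i              ≈⟨ R.+-congʳ (coeff-+ p q i) ⟩
      (coeff p i R.+ coeff q i) R.+ coeff r i    ≈⟨ R.+-assoc _ _ _ ⟩
      coeff p i R.+ (coeff q i R.+ coeff r i)    ≈⟨ R.+-congˡ (coeff-+ q r i) ⟨
      coeff p i R.+ coeff (q + r) i              ≈⟨ coeff-+ p (q + r) i ⟨
      coeff (p + (q + r)) i                      ∎
      where open SetoidReasoning R.setoid

    +-comm : ∀ p q → p + q ≈ q + p
    +-comm p q = mk≈ λ i →
      R.trans (coeff-+ p q i) (R.trans (R.+-comm _ _) (R.sym (coeff-+ q p i)))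

    +-identityʳ : ∀ p → p + [] ≈ p
    +-identityʳ p = +-comm p []

    neg-cong : ∀ {p q} → p ≈ q → - p ≈ - q
    neg-cong {p} {q} e = mk≈ λ i →
      R.trans (coeff-neg p i) (R.trans (R.-‿cong (at e i)) (R.sym (coeff-neg q i)))

    +-inverseˡ : ∀ p → - p + p ≈ []
    +-inverseˡ p = mk≈ λ i →
      R.trans (coeff-+ (- p) p i) (R.trans (R.+-congʳ (coeff-neg p i)) (R.-‿inverseˡ _))

    ∙-cong : ∀ {a b p q} → a R.≈ b → p ≈ q → a ∙ p ≈ b ∙ q
    ∙-cong {a} {b} {p} {q} e f = mk≈ λ i →
      R.trans (coeff-∙ a p i) (R.trans (R.*-cong e (at f i)) (R.sym (coeff-∙ b q i)))

    ∙-distribˡ : ∀ a p q → a ∙ (p + q) ≈ a ∙ p + a ∙ q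
    ∙-distribˡ a p q = mk≈ λ i → begin
      coeff (a ∙ (p + q)) i                      ≈⟨ coeff-∙ a (p + q) i ⟩
      a R.* coeff (p + q) i                      ≈⟨ R.*-congˡ (coeff-+ p q i) ⟩
      a R.* (coeff p i R.+ coeff q i)            ≈⟨ R.distribˡ _ _ _ ⟩
      a R.* coeff p i R.+ a R.* coeff q i        ≈⟨ R.+-cong (coeff-∙ a p i) (coeff-∙ a q i) ⟨
      coeff (a ∙ p) i R.+ coeff (a ∙ q) i        ≈⟨ coeff-+ (a ∙ p) (a ∙ q) i ⟨
      coeff (a ∙ p + a ∙ q) i                    ∎
      where open SetoidReasoning R.setoid

    ∙-distribʳ : ∀ a b p → (a R.+ b) ∙ p ≈ a ∙ p + b ∙ p
    ∙-distribʳ a b p = mk≈ λ i → begin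
      coeff ((a R.+ b) ∙ p) i                    ≈⟨ coeff-∙ (a R.+ b) p i ⟩
      (a R.+ b) R.* coeff p i                    ≈⟨ R.distribʳ _ _ _ ⟩
      a R.* coeff p i R.+ b R.* coeff p i        ≈⟨ R.+-cong (coeff-∙ a p i) (coeff-∙ b p i) ⟨
      coeff (a ∙ p) i R.+ coeff (b ∙ p) i        ≈⟨ coeff-+ (a ∙ p) (b ∙ p) i ⟨
      coeff (a ∙ p + b ∙ p) i                    ∎
      where open SetoidReasoning R.setoid

    ∙-assoc : ∀ a b p → (a R.* b) ∙ p ≈ a ∙ (b ∙ p)
    ∙-assoc a b p = mk≈ λ i → begin
      coeff ((a R.* b) ∙ p) i    ≈⟨ coeff-∙ (a R.* b) p i ⟩
      (a R.* b) R.* coeff p i    ≈⟨ R.*-assoc _ _ _ ⟩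
      a R.* (b R.* coeff p i)    ≈⟨ R.*-congˡ (coeff-∙ b p i) ⟨
      a R.* coeff (b ∙ p) i      ≈⟨ coeff-∙ a (b ∙ p) i ⟨
      coeff (a ∙ (b ∙ p)) i      ∎
      where open SetoidReasoning R.setoid

    0∙ : ∀ {a} p → a R.≈ R.0# → a ∙ p ≈ []
    0∙ {a} p e = mk≈ λ i → R.trans (coeff-∙ a p i) (R.trans (R.*-congʳ e) (R.zeroˡ _))

    1∙ : ∀ p → R.1# ∙ p ≈ p
    1∙ p = mk≈ λ i → R.trans (coeff-∙ R.1# p i) (R.*-identityˡ _)

    ≈-setoid : Setoid c ℓ
    ≈-setoid = record
      { isEquivalence = record
        { refl = λ {p} → ≈-refl {p} ; sym = ≈-sym ; trans = ≈-trans } }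

    open SetoidReasoning ≈-setoid

    interchange : ∀ p q r s → (p + q) + (r + s) ≈ (p + r) + (q + s)
    interchange p q r s = begin
      (p + q) + (r + s)    ≈⟨ +-assoc p q (r + s) ⟩
      p + (q + (r + s))    ≈⟨ +-cong (≈-refl {p}) swap ⟩
      p + (r + (q + s))    ≈⟨ +-assoc p r (q + s) ⟨
      (p + r) + (q + s)    ∎
      where
      swap : q + (r + s) ≈ r + (q + s)
      swap = begin
        q + (r + s)    ≈⟨ +-assoc q r s ⟨
        (q + r) + s    ≈⟨ +-cong (+-comm q r) (≈-refl {s}) ⟩
        (r + q) + s    ≈⟨ +-assoc r q s ⟩
        r + (q + s)    ∎

    0∷-+ : ∀ p q → R.0# ∷ (p + q) ≈ (R.0# ∷ p) + (R.0# ∷ q)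
    0∷-+ p q = ∷-cong (R.sym (R.+-identityˡ _)) ≈-refl

    []*-cong : ∀ p q → p ≈ [] → p * q ≈ []
    []*-cong []      q e = ≈-refl
    []*-cong (a ∷ p) q e = begin
      a ∙ q + (R.0# ∷ p * q)    ≈⟨ +-cong (0∙ q (at e zero)) (∷-cong R.refl ([]*-cong p q (tail-≈[] e))) ⟩
      R.0# ∷ []                 ≈⟨ 0∷[] ⟩
      []                        ∎

    *-congˡ : ∀ p {q r} → q ≈ r → p * q ≈ p * r
    *-congˡ []      e = ≈-refl
    *-congˡ (a ∷ p) e = +-cong (∙-cong R.refl e) (∷-cong R.refl (*-congˡ p e))

    *-congʳ : ∀ {p q} r → p ≈ q → p * r ≈ q * r
    *-congʳ {[]}    {q}     r e = ≈-sym ([]*-cong q r (≈-sym e))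
    *-congʳ {a ∷ p} {[]}    r e = []*-cong (a ∷ p) r e
    *-congʳ {a ∷ p} {b ∷ q} r e =
      +-cong (∙-cong (head-≈ e) (≈-refl {r})) (∷-cong R.refl (*-congʳ r (tail-≈ e)))

    *-cong : ∀ {p q r s} → p ≈ q → r ≈ s → p * r ≈ q * s
    *-cong {q = q} {r = r} e f = ≈-trans (*-congʳ r e) (*-congˡ q f)

    *-[] : ∀ p → p * [] ≈ []
    *-[] []      = ≈-refl
    *-[] (a ∷ p) = ≈-trans (∷-cong R.refl (*-[] p)) 0∷[]

    *-∷ : ∀ p b q → p * (b ∷ q) ≈ b ∙ p + (R.0# ∷ p * q)
    *-∷ []      b q = ≈-sym 0∷[]
    *-∷ (a ∷ p) b q = ∷-cong (R.+-congʳ (R.*-comm a b)) (begin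
      a ∙ q + p * (b ∷ q)                    ≈⟨ +-cong (≈-refl {a ∙ q}) (*-∷ p b q) ⟩
      a ∙ q + (b ∙ p + (R.0# ∷ p * q))       ≈⟨ +-assoc (a ∙ q) (b ∙ p) _ ⟨
      (a ∙ q + b ∙ p) + (R.0# ∷ p * q)       ≈⟨ +-cong (+-comm (a ∙ q) (b ∙ p)) ≈-refl ⟩
      (b ∙ p + a ∙ q) + (R.0# ∷ p * q)       ≈⟨ +-assoc (b ∙ p) (a ∙ q) _ ⟩
      b ∙ p + (a ∙ q + (R.0# ∷ p * q))       ∎)

    *-comm : ∀ p q → p * q ≈ q * p
    *-comm []      q = ≈-sym (*-[] q)
    *-comm (a ∷ p) q = begin
      a ∙ q + (R.0# ∷ p * q)    ≈⟨ +-cong (≈-refl {a ∙ q}) (∷-cong R.refl (*-comm p q)) ⟩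
      a ∙ q + (R.0# ∷ q * p)    ≈⟨ *-∷ q a p ⟨
      q * (a ∷ p)               ∎

    distribʳ : ∀ r p q → (p + q) * r ≈ p * r + q * r
    distribʳ r []      q       = ≈-refl
    distribʳ r (a ∷ p) []      = ≈-sym (+-identityʳ _)
    distribʳ r (a ∷ p) (b ∷ q) = begin
      (a R.+ b) ∙ r + (R.0# ∷ (p + q) * r)
        ≈⟨ +-cong (∙-distribʳ a b r) (∷-cong R.refl (distribʳ r p q)) ⟩
      (a ∙ r + b ∙ r) + (R.0# ∷ (p * r + q * r))
        ≈⟨ +-cong (≈-refl {a ∙ r + b ∙ r}) (0∷-+ (p * r) (q * r)) ⟩
      (a ∙ r + b ∙ r) + ((R.0# ∷ p * r) + (R.0# ∷ q * r))
        ≈⟨ interchange (a ∙ r) (b ∙ r) (R.0# ∷ p * r) (R.0# ∷ q * r) ⟩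
      (a ∷ p) * r + (b ∷ q) * r ∎

    ∙-*-assoc : ∀ a p q → (a ∙ p) * q ≈ a ∙ (p * q)
    ∙-*-assoc a []      q = ≈-refl
    ∙-*-assoc a (b ∷ p) q = begin
      (a R.* b) ∙ q + (R.0# ∷ (a ∙ p) * q)
        ≈⟨ +-cong (∙-assoc a b q) (∷-cong (R.sym (R.zeroʳ a)) (∙-*-assoc a p q)) ⟩
      a ∙ (b ∙ q) + a ∙ (R.0# ∷ p * q)
        ≈⟨ ∙-distribˡ a (b ∙ q) (R.0# ∷ p * q) ⟨
      a ∙ (b ∙ q + (R.0# ∷ p * q)) ∎

    0∷-* : ∀ p q → (R.0# ∷ p) * q ≈ R.0# ∷ p * q
    0∷-* p q = +-cong (0∙ q R.refl) ≈-refl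

    *-assoc : ∀ p q r → (p * q) * r ≈ p * (q * r)
    *-assoc []      q r = ≈-refl
    *-assoc (a ∷ p) q r = begin
      (a ∙ q + (R.0# ∷ p * q)) * r             ≈⟨ distribʳ r (a ∙ q) (R.0# ∷ p * q) ⟩
      (a ∙ q) * r + (R.0# ∷ p * q) * r         ≈⟨ +-cong (∙-*-assoc a q r) (0∷-* (p * q) r) ⟩
      a ∙ (q * r) + (R.0# ∷ (p * q) * r)       ≈⟨ +-cong (≈-refl {a ∙ (q * r)}) (∷-cong R.refl (*-assoc p q r)) ⟩
      a ∙ (q * r) + (R.0# ∷ p * (q * r))       ∎

    *-identityˡ : ∀ p → const R.1# * p ≈ p
    *-identityˡ p = begin
      R.1# ∙ p + (R.0# ∷ [])    ≈⟨ +-cong (1∙ p) 0∷[] ⟩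
      p + []                    ≈⟨ +-identityʳ p ⟩
      p                         ∎

    ≈[]? : ∀ p → Dec (p ≈ [])
    ≈[]? []      = yes ≈-refl
    ≈[]? (a ∷ p) = map′
      (λ (a≈0 , p≈0) → ≈-trans (∷-cong a≈0 p≈0) 0∷[])
      (λ e → at e zero , tail-≈[] e)
      (R.≈0? a ×-dec ≈[]? p)

    0∷-≉ : ∀ {p q} → q ≈ R.0# ∷ p → ¬ p ≈ [] → ¬ q ≈ []
    0∷-≉ e p≉0 q≈0 = p≉0 (tail-≈[] (≈-trans (≈-sym e) q≈0))

    strip : ∀ {a p} → a R.≈ R.0# → ¬ (a ∷ p) ≈ [] → ¬ p ≈ []
    strip a≈0 a∷p≉0 p≈0 = a∷p≉0 (≈-trans (∷-cong a≈0 p≈0) 0∷[])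

    *-≉[]-head : ∀ {a} p q → ¬ a R.≈ R.0# → ¬ q ≈ [] → ¬ (a ∷ p) * q ≈ []
    *-≉[]-head     p []      a≉0 q≉0 = λ _ → q≉0 ≈-refl
    *-≉[]-head {a} p (b ∷ q) a≉0 q≉0 with R.≈0? b
    ... | no b≉0  = λ e →
      R.*-≉0 a≉0 b≉0 (R.trans (R.sym (R.+-identityʳ _)) (at e zero))
    ... | yes b≈0 = 0∷-≉
      (begin
        (a ∷ p) * (b ∷ q)       ≈⟨ *-congˡ (a ∷ p) (∷-cong b≈0 ≈-refl) ⟩
        (a ∷ p) * (R.0# ∷ q)    ≈⟨ *-comm (a ∷ p) (R.0# ∷ q) ⟩
        (R.0# ∷ q) * (a ∷ p)    ≈⟨ 0∷-* q (a ∷ p) ⟩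
        R.0# ∷ q * (a ∷ p)      ≈⟨ ∷-cong R.refl (*-comm q (a ∷ p)) ⟩
        R.0# ∷ (a ∷ p) * q      ∎)
      (*-≉[]-head p q a≉0 (strip b≈0 q≉0))

    *-≉[] : ∀ p q → ¬ p ≈ [] → ¬ q ≈ [] → ¬ p * q ≈ []
    *-≉[] []      q p≉0 q≉0 = λ _ → p≉0 ≈-refl
    *-≉[] (a ∷ p) q p≉0 q≉0 with R.≈0? a
    ... | no a≉0  = *-≉[]-head p q a≉0 q≉0
    ... | yes a≈0 = 0∷-≉
      (≈-trans (*-congʳ {a ∷ p} {R.0# ∷ p} q (∷-cong a≈0 ≈-refl)) (0∷-* p q))
      (*-≉[] p q (strip a≈0 p≉0) q≉0)

  polynomialRing : CommutativeRing c ℓ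
  polynomialRing = record
    { Carrier = Poly
    ; _≈_     = _≈_
    ; _+_     = _+_
    ; _*_     = _*_
    ; -_      = -_
    ; 0#      = []
    ; 1#      = const R.1#
    ; isCommutativeRing = record
      { isRing = record
        { +-isAbelianGroup = record
          { isGroup = record
            { isMonoid = record
              { isSemigroup = record
                { isMagma = record
                  { isEquivalence = record { refl = ≈-refl ; sym = ≈-sym ; trans = ≈-trans }
                  ; ∙-cong        = +-cong
                  }
                ; assoc = +-assoc
                }
              ; identity = (λ _ → ≈-refl) , +-identityʳ
              }
            ; inverse = +-inverseˡ , (λ p → ≈-trans (+-comm p (- p)) (+-inverseˡ p))
            ; ⁻¹-cong = neg-cong
            }
          ; comm = +-comm
          }
        ; *-cong     = *-cong
        ; *-assoc    = *-assoc
        ; *-identity = *-identityˡ , (λ p → ≈-trans (*-comm p (const R.1#)) (*-identityˡ p))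
        ; distrib    = Consequences.comm∧distrʳ⇒distr ≈-setoid +-cong *-comm distribʳ
        }
      ; *-comm = *-comm
      }
    }

  polynomialDomain : IntegralDomain c ℓ
  polynomialDomain = record
    { commutativeRing = polynomialRing
    ; 1≉0             = λ e → R.1≉0 (at e zero)
    ; ≈0?             = ≈[]?
    ; *-≉0            = λ {p} {q} → *-≉[] p q
    }

module Fractions {c ℓ} (R : IntegralDomain c ℓ) where
  private module R = IntegralDomain R

  infix 4 _≈_

  record Fraction : Set (c ⊔ ℓ) where
    constructor mkFraction
    field
      num   : R.Carrier
      den   : R.Carrier
      den≉0 : ¬ den R.≈ R.0#
  open Fraction public

  record _≈_ (p q : Fraction) : Set ℓ where
    constructor mk≈
    field cross : num p R.* den q R.≈ num q R.* den p
  open _≈_ public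

  fraction : R.Carrier → Fraction
  fraction a = mkFraction a R.1# R.1≉0

  private
    module S = Solver R.commutativeSemiring
    open S using (_:=_; _:+_; _:*_; con)

    infixl 6 _+_
    infixl 7 _*_
    infix  8 -_

    _+_ : Fraction → Fraction → Fraction
    mkFraction a b b≉0 + mkFraction c d d≉0 =
      mkFraction (a R.* d R.+ c R.* b) (b R.* d) (R.*-≉0 b≉0 d≉0)

    _*_ : Fraction → Fraction → Fraction
    mkFraction a b b≉0 * mkFraction c d d≉0 =
      mkFraction (a R.* c) (b R.* d) (R.*-≉0 b≉0 d≉0)

    -_ : Fraction → Fraction
    - mkFraction a b b≉0 = mkFraction (R.- a) b b≉0

    open SetoidReasoning R.setoid

    cancel : ∀ {a b d} → ¬ d R.≈ R.0# → a R.* d R.≈ b R.* d → a R.≈ b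
    cancel {a} {b} {d} d≉0 e with R.≈0? (a R.- b)
    ... | yes a-b≈0 = begin
      a                          ≈⟨ R.+-identityʳ a ⟨
      a R.+ R.0#                 ≈⟨ R.+-congˡ (R.-‿inverseˡ b) ⟨
      a R.+ (R.- b R.+ b)        ≈⟨ R.+-assoc _ _ _ ⟨
      (a R.- b) R.+ b            ≈⟨ R.+-congʳ a-b≈0 ⟩
      R.0# R.+ b                 ≈⟨ R.+-identityˡ b ⟩
      b                          ∎
    ... | no a-b≉0 = ⊥-elim (R.*-≉0 a-b≉0 d≉0 (begin
      (a R.- b) R.* d                  ≈⟨ R.distribʳ _ _ _ ⟩
      a R.* d R.+ (R.- b) R.* d        ≈⟨ R.+-cong e (R.sym (R.-‿distribˡ-* b d)) ⟩
      b R.* d R.+ R.- (b R.* d)        ≈⟨ R.-‿inverseʳ _ ⟩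
      R.0#                             ∎))

    ≈-refl : ∀ {p} → p ≈ p
    ≈-refl = mk≈ R.refl

    ≈-sym : ∀ {p q} → p ≈ q → q ≈ p
    ≈-sym e = mk≈ (R.sym (cross e))

    ≈-trans : ∀ {p q r} → p ≈ q → q ≈ r → p ≈ r
    ≈-trans {mkFraction a b _} {mkFraction c d d≉0} {mkFraction e f _} (mk≈ ad≈cb) (mk≈ cf≈ed) =
      mk≈ (cancel d≉0 (begin
        (a R.* f) R.* d    ≈⟨ S.solve 3 (λ a f d → (a :* f) :* d := (a :* d) :* f) R.refl a f d ⟩
        (a R.* d) R.* f    ≈⟨ R.*-congʳ ad≈cb ⟩
        (c R.* b) R.* f    ≈⟨ S.solve 3 (λ c b f → (c :* b) :* f := (c :* f) :* b) R.refl c b f ⟩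
        (c R.* f) R.* b    ≈⟨ R.*-congʳ cf≈ed ⟩
        (e R.* d) R.* b    ≈⟨ S.solve 3 (λ e d b → (e :* d) :* b := (e :* b) :* d) R.refl e d b ⟩
        (e R.* b) R.* d    ∎))

    +-cong : ∀ {p q r s} → p ≈ q → r ≈ s → p + r ≈ q + s
    +-cong {mkFraction a b _} {mkFraction a′ b′ _} {mkFraction c d _} {mkFraction c′ d′ _} (mk≈ e) (mk≈ f) =
      mk≈ (begin
        (a R.* d R.+ c R.* b) R.* (b′ R.* d′)
          ≈⟨ S.solve 6 (λ a b c d b′ d′ → (a :* d :+ c :* b) :* (b′ :* d′)
                := (a :* b′) :* (d :* d′) :+ (c :* d′) :* (b :* b′)) R.refl a b c d b′ d′ ⟩
        (a R.* b′) R.* (d R.* d′) R.+ (c R.* d′) R.* (b R.* b′)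
          ≈⟨ R.+-cong (R.*-congʳ e) (R.*-congʳ f) ⟩
        (a′ R.* b) R.* (d R.* d′) R.+ (c′ R.* d) R.* (b R.* b′)
          ≈⟨ S.solve 6 (λ a′ b′ c′ d′ b d → (a′ :* b) :* (d :* d′) :+ (c′ :* d) :* (b :* b′)
                := (a′ :* d′ :+ c′ :* b′) :* (b :* d)) R.refl a′ b′ c′ d′ b d ⟩
        (a′ R.* d′ R.+ c′ R.* b′) R.* (b R.* d) ∎)

    *-cong : ∀ {p q r s} → p ≈ q → r ≈ s → p * r ≈ q * s
    *-cong {mkFraction a b _} {mkFraction a′ b′ _} {mkFraction c d _} {mkFraction c′ d′ _} (mk≈ e) (mk≈ f) =
      mk≈ (begin
        (a R.* c) R.* (b′ R.* d′)
          ≈⟨ S.solve 4 (λ a c b′ d′ → (a :* c) :* (b′ :* d′) := (a :* b′) :* (c :* d′)) R.refl a c b′ d′ ⟩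
        (a R.* b′) R.* (c R.* d′)
          ≈⟨ R.*-cong e f ⟩
        (a′ R.* b) R.* (c′ R.* d)
          ≈⟨ S.solve 4 (λ a′ b c′ d → (a′ :* b) :* (c′ :* d) := (a′ :* c′) :* (b :* d)) R.refl a′ b c′ d ⟩
        (a′ R.* c′) R.* (b R.* d) ∎)

    neg-cong : ∀ {p q} → p ≈ q → - p ≈ - q
    neg-cong {mkFraction a b _} {mkFraction c d _} (mk≈ e) = mk≈ (begin
      (R.- a) R.* d      ≈⟨ R.-‿distribˡ-* a d ⟨
      R.- (a R.* d)      ≈⟨ R.-‿cong e ⟩
      R.- (c R.* b)      ≈⟨ R.-‿distribˡ-* c b ⟩
      (R.- c) R.* b      ∎)

    +-assoc : ∀ p q r → (p + q) + r ≈ p + (q + r)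
    +-assoc (mkFraction a b _) (mkFraction c d _) (mkFraction e f _) = mk≈
      (S.solve 6 (λ a b c d e f →
        ((a :* d :+ c :* b) :* f :+ e :* (b :* d)) :* (b :* (d :* f))
          := (a :* (d :* f) :+ (c :* f :+ e :* d) :* b) :* ((b :* d) :* f)) R.refl a b c d e f)

    +-comm : ∀ p q → p + q ≈ q + p
    +-comm (mkFraction a b _) (mkFraction c d _) = mk≈
      (S.solve 4 (λ a b c d → (a :* d :+ c :* b) :* (d :* b) := (c :* b :+ a :* d) :* (b :* d)) R.refl a b c d)

    +-identityˡ : ∀ p → fraction R.0# + p ≈ p
    +-identityˡ (mkFraction a b _) = mk≈
      (S.solve 2 (λ a b → (con 0 :* b :+ a :* con 1) :* b := a :* (con 1 :* b)) R.refl a b)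

    +-inverseˡ : ∀ p → - p + p ≈ fraction R.0#
    +-inverseˡ (mkFraction a b _) = mk≈ (begin
      ((R.- a) R.* b R.+ a R.* b) R.* R.1#      ≈⟨ R.*-identityʳ _ ⟩
      (R.- a) R.* b R.+ a R.* b                 ≈⟨ R.distribʳ _ _ _ ⟨
      (R.- a R.+ a) R.* b                       ≈⟨ R.*-congʳ (R.-‿inverseˡ a) ⟩
      R.0# R.* b                                ≈⟨ R.zeroˡ b ⟩
      R.0#                                      ≈⟨ R.zeroˡ _ ⟨
      R.0# R.* (b R.* b)                        ∎)

    *-assoc : ∀ p q r → (p * q) * r ≈ p * (q * r)
    *-assoc (mkFraction a b _) (mkFraction c d _) (mkFraction e f _) = mk≈
      (S.solve 6 (λ a b c d e f →
        ((a :* c) :* e) :* (b :* (d :* f)) := (a :* (c :* e)) :* ((b :* d) :* f)) R.refl a b c d e f)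

    *-comm : ∀ p q → p * q ≈ q * p
    *-comm (mkFraction a b _) (mkFraction c d _) = mk≈
      (S.solve 4 (λ a b c d → (a :* c) :* (d :* b) := (c :* a) :* (b :* d)) R.refl a b c d)

    *-identityˡ : ∀ p → fraction R.1# * p ≈ p
    *-identityˡ (mkFraction a b _) = mk≈
      (S.solve 2 (λ a b → (con 1 :* a) :* b := a :* (con 1 :* b)) R.refl a b)

    distribʳ : ∀ r p q → (p + q) * r ≈ p * r + q * r
    distribʳ (mkFraction e f _) (mkFraction a b _) (mkFraction c d _) = mk≈
      (S.solve 6 (λ a b c d e f →
        ((a :* d :+ c :* b) :* e) :* ((b :* f) :* (d :* f))
          := ((a :* e) :* (d :* f) :+ (c :* e) :* (b :* f)) :* ((b :* d) :* f)) R.refl a b c d e f)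

  fractionField : CommutativeRing (c ⊔ ℓ) ℓ
  fractionField = record
    { Carrier = Fraction
    ; _≈_     = _≈_
    ; _+_     = _+_
    ; _*_     = _*_
    ; -_      = -_
    ; 0#      = fraction R.0#
    ; 1#      = fraction R.1#
    ; isCommutativeRing = record
      { isRing = record
        { +-isAbelianGroup = record
          { isGroup = record
            { isMonoid = record
              { isSemigroup = record
                { isMagma = record
                  { isEquivalence = isEquivalence
                  ; ∙-cong        = +-cong
                  }
                ; assoc = +-assoc
                }
              ; identity = +-identityˡ , (λ p → ≈-trans (+-comm p (fraction R.0#)) (+-identityˡ p))
              }
            ; inverse = +-inverseˡ , (λ p → ≈-trans (+-comm p (- p)) (+-inverseˡ p))
            ; ⁻¹-cong = neg-cong
            }
          ; comm = +-comm
          }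
        ; *-cong     = *-cong
        ; *-assoc    = *-assoc
        ; *-identity = *-identityˡ , (λ p → ≈-trans (*-comm p (fraction R.1#)) (*-identityˡ p))
        ; distrib    = Consequences.comm∧distrʳ⇒distr (record { isEquivalence = isEquivalence }) +-cong *-comm distribʳ
        }
      ; *-comm = *-comm
      }
    }
    where
    isEquivalence : IsEquivalence _≈_
    isEquivalence = record { refl = ≈-refl ; sym = ≈-sym ; trans = ≈-trans }

-- ℤ[x,y] is built as ℤ[x][y], and ℚ(x,y) as the fraction field of ℤ[x,y].
-- In both, n · p is the n-fold sum p + ⋯ + p.

private
  module ℤ[x]   = Polynomials ℤ-domain
  module ℤ[x][y] = Polynomials ℤ[x].polynomialDomain

ℤ[x,y]-domain : IntegralDomain _ _
ℤ[x,y]-domain = ℤ[x][y].polynomialDomain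

module ℤ[x,y] where
  open IntegralDomain ℤ[x,y]-domain public
  open Exp semiring public using (_^_)
  open Mult semiring public using () renaming (_×_ to infixr 8 _·_)

  x y : Carrier
  x = ℤ[x][y].const ℤ[x].X
  y = ℤ[x][y].X

  x-1≉0 : ¬ x - 1# ≈ 0#
  x-1≉0 e with ℤ[x].at (ℤ[x][y].at e 0) 1
  ... | ()

module ℚ⟨x,y⟩ where
  open Fractions ℤ[x,y]-domain public using (fraction; mkFraction; fractionField)
  open CommutativeRing fractionField public
  open Exp semiring public using (_^_)
  open Mult semiring public using () renaming (_×_ to infixr 8 _·_)

  x y 1/[x-1] : Carrier
  x = fraction ℤ[x,y].x
  y = fraction ℤ[x,y].y
  1/[x-1] = mkFraction ℤ[x,y].1# (ℤ[x,y].x ℤ[x,y].- ℤ[x,y].1#) ℤ[x,y].x-1≉0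

-- Edges are indexed, so parallel edges are distinct; the order of the two
-- ends of an edge is immaterial (connectivity below is symmetrised).
record Graph : Set where
  field
    #V #E : ℕ
    ends  : Vec (Fin #V × Fin #V) #E

module Connectivity {v : ℕ} where

  Adjacent : ∀ {m} → Vec (Fin v × Fin v) m → Subset m → Fin v → Fin v → Set
  Adjacent es A u w = ∃ λ e → e Subset.∈ A × lookup es e ≡ (u , w)

  Connected : ∀ {m} → Vec (Fin v × Fin v) m → Subset m → Fin v → Fin v → Set
  Connected es A = EqClosure (Adjacent es A)

  weaken : ∀ {m e} {es : Vec _ m} {s : Side} {A u w} →
           Connected es A u w → Connected (e ∷ es) (s ∷ A) u w
  weaken = Eq.map λ (i , i∈A , eq) → suc i , there i∈A , eq

  strengthen : ∀ {m e} {es : Vec _ m} {A u w} →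
               Connected (e ∷ es) (outside ∷ A) u w → Connected es A u w
  strengthen = Eq.map λ { (suc i , there i∈A , eq) → i , i∈A , eq }

  -- Connectivity of u and w once the edge {a , b} is added to A.
  Via : ∀ {m} → Fin v × Fin v → Vec (Fin v × Fin v) m → Subset m → Fin v → Fin v → Set
  Via (a , b) es A u w =
    Connected es A u w ⊎
    (Connected es A u a × Connected es A b w ⊎ Connected es A u b × Connected es A a w)

  via⇒ : ∀ {m e} {es : Vec _ m} {A u w} →
         Via e es A u w → Connected (e ∷ es) (inside ∷ A) u w
  via⇒ (inj₁ p)              = weaken p
  via⇒ (inj₂ (inj₁ (p , q))) = weaken p ◅◅ fwd (zero , here , refl) ◅ weaken q
  via⇒ (inj₂ (inj₂ (p , q))) = weaken p ◅◅ bwd (zero , here , refl) ◅ weaken q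

  via⇐ : ∀ {m e} {es : Vec _ m} {A u w} →
         Connected (e ∷ es) (inside ∷ A) u w → Via e es A u w
  via⇐ ε = inj₁ ε
  via⇐ (fwd (suc i , there i∈A , eq) ◅ p) with via⇐ p
  ... | inj₁ q              = inj₁ (fwd (i , i∈A , eq) ◅ q)
  ... | inj₂ (inj₁ (q , r)) = inj₂ (inj₁ (fwd (i , i∈A , eq) ◅ q , r))
  ... | inj₂ (inj₂ (q , r)) = inj₂ (inj₂ (fwd (i , i∈A , eq) ◅ q , r))
  via⇐ (bwd (suc i , there i∈A , eq) ◅ p) with via⇐ p
  ... | inj₁ q              = inj₁ (bwd (i , i∈A , eq) ◅ q)
  ... | inj₂ (inj₁ (q , r)) = inj₂ (inj₁ (bwd (i , i∈A , eq) ◅ q , r))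
  ... | inj₂ (inj₂ (q , r)) = inj₂ (inj₂ (bwd (i , i∈A , eq) ◅ q , r))
  via⇐ (fwd (zero , here , refl) ◅ p) with via⇐ p
  ... | inj₁ q              = inj₂ (inj₁ (ε , q))
  ... | inj₂ (inj₁ (q , r)) = inj₂ (inj₁ (ε , r))
  ... | inj₂ (inj₂ (q , r)) = inj₁ r
  via⇐ (bwd (zero , here , refl) ◅ p) with via⇐ p
  ... | inj₁ q              = inj₂ (inj₂ (ε , q))
  ... | inj₂ (inj₁ (q , r)) = inj₁ r
  ... | inj₂ (inj₂ (q , r)) = inj₂ (inj₂ (ε , r))

  connected? : ∀ {m} (es : Vec (Fin v × Fin v) m) A → Decidable (Connected es A)
  connected? [] [] u w = map′ (λ { refl → ε }) from (u ≟ᶠ w)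
    where
    from : Connected [] [] u w → u ≡ w
    from ε                  = refl
    from (fwd (() , _) ◅ _)
    from (bwd (() , _) ◅ _)
  connected? (e ∷ es) (outside ∷ A) u w = map′ weaken strengthen (connected? es A u w)
  connected? ((a , b) ∷ es) (inside ∷ A) u w = map′ via⇒ via⇐
    (connected? es A u w ⊎-dec
      ((connected? es A u a ×-dec connected? es A b w) ⊎-dec
       (connected? es A u b ×-dec connected? es A a w)))

allSubsets : ∀ m → List (Subset m)
allSubsets zero    = [] ∷ []
allSubsets (suc m) =
  List.map (outside ∷_) (allSubsets m) List.++ List.map (inside ∷_) (allSubsets m)

module _ (G : Graph) where
  open Graph G

  -- A spanning subgraph is given by its set of edges.
  SpanningSubgraph : Set
  SpanningSubgraph = Subset #E

  spanningSubgraphs : List SpanningSubgraph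
  spanningSubgraphs = allSubsets #E

module _ (G : Graph) (A : SpanningSubgraph G) where
  open Graph G

  Connected : Fin #V → Fin #V → Set
  Connected = Connectivity.Connected ends A

  connected? : Decidable Connected
  connected? = Connectivity.connected? ends A

  -- Deduplication keeps exactly one vertex of each component.
  components : ℕ
  components = length (deduplicate connected? (allFin #V))

  -- Truncated subtraction is exact here and below: components ≤ #V,
  -- rank A ≤ ∣ A ∣ and rank A ≤ rank ⊤.
  rank : ℕ
  rank = #V ∸ components

  nullity : ℕ
  nullity = ∣ A ∣ ∸ rank

-- G is the spanning subgraph of itself with all edges, whence rank G ⊤ for r(G).
weight : (G : Graph) → SpanningSubgraph G → ℤ[x,y].Carrier
weight G A = (x - 1#) ^ (rank G ⊤ ∸ rank G A) * (y - 1#) ^ nullity G A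
  where open ℤ[x,y]

totalWeight : (G : Graph) → List (SpanningSubgraph G) → ℤ[x,y].Carrier
totalWeight G As = foldr ℤ[x,y]._+_ ℤ[x,y].0# (List.map (weight G) As)

tutte : Graph → ℤ[x,y].Carrier
tutte G = totalWeight G (spanningSubgraphs G)

record OutmostGraph : Set where
  field
    graph : Graph
  open Graph graph public
  field
    top left right : Fin #V

triangle : OutmostGraph
triangle = record
  { graph = record
    { #V   = 3
    ; #E   = 3
    ; ends = (0F , 1F) ∷ (0F , 2F) ∷ (1F , 2F) ∷ []
    }
  ; top   = 0F
  ; left  = 1F
  ; right = 2F
  }

-- Vertex v of the copy Gᵢ (i = 1, 2, 3) is combine (i − 1) v : Fin (3 * #V).
glue : OutmostGraph → OutmostGraph
glue G = record
  { graph = record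
    { #V   = 3 ℕ.* #V
    ; #E   = #E ℕ.+ (#E ℕ.+ (#E ℕ.+ 3))
    ; ends = edges G₁ ++ (edges G₂ ++ (edges G₃ ++ special))
    }
  ; top   = G₁ top
  ; left  = G₂ left
  ; right = G₃ right
  }
  where
  open OutmostGraph G

  G₁ G₂ G₃ : Fin #V → Fin (3 ℕ.* #V)
  G₁ = combine {3} 0F
  G₂ = combine {3} 1F
  G₃ = combine {3} 2F

  edges : (Fin #V → Fin (3 ℕ.* #V)) → Vec (Fin (3 ℕ.* #V) × Fin (3 ℕ.* #V)) #E
  edges copy = Vec.map (map copy copy) ends

  special : Vec (Fin (3 ℕ.* #V) × Fin (3 ℕ.* #V)) 3
  special = (G₁ left , G₂ top) ∷ (G₁ right , G₃ top) ∷ (G₂ right , G₃ left) ∷ []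

Sigma : (n : ℕ) → .{{NonZero n}} → OutmostGraph
Sigma (suc zero)        = triangle
Sigma (suc n@(suc _))   = glue (Sigma n)

module _ (G : OutmostGraph) where
  open OutmostGraph G

  AllTogether LeftRightOnly AllSeparate : SpanningSubgraph graph → Set
  AllTogether   A = Connected graph A top left × Connected graph A left right
  LeftRightOnly A = Connected graph A left right × ¬ Connected graph A top left
  AllSeparate   A = ¬ Connected graph A top left × ¬ Connected graph A top right × ¬ Connected graph A left right

  allTogether? : ∀ A → Dec (AllTogether A)
  allTogether? A = connected? graph A top left ×-dec connected? graph A left right

  leftRightOnly? : ∀ A → Dec (LeftRightOnly A)
  leftRightOnly? A = connected? graph A left right ×-dec ¬? (connected? graph A top left)

  allSeparate? : ∀ A → Dec (AllSeparate A)
  allSeparate? A =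
    ¬? (connected? graph A top left) ×-dec ¬? (connected? graph A top right) ×-dec ¬? (connected? graph A left right)

module _ (n : ℕ) .{{_ : NonZero n}} where
  open OutmostGraph (Sigma n) using (graph)

  H H₂ H₁ H₀ : ℤ[x,y].Carrier
  H  = tutte graph
  H₂ = totalWeight graph (filter (allTogether?   (Sigma n)) (spanningSubgraphs graph))
  H₁ = totalWeight graph (filter (leftRightOnly? (Sigma n)) (spanningSubgraphs graph))
  H₀ = totalWeight graph (filter (allSeparate?   (Sigma n)) (spanningSubgraphs graph))

{-# OPTIONS --safe #-}
module Submission where

-- The partition that a spanning subgraph induces on the three outmost vertices is one of five
-- states.  A spanning subgraph of Σ_{n+1} consists of spanning subgraphs A₁, A₂, A₃ of the copies and
-- a set S of special edges.  Adding the edges of S one at a time lowers the number of components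
-- by 1 whenever the two ends are not yet connected, m times in all, which only depends on S and
-- the three states; so does the resulting state.  Since k(A) + m = k(A₁) + k(A₂) + k(A₃), the
-- weight of A is (x-1)^(2-m) (y-1)^(|S|-m) times the product of the weights of the Aᵢ, and the
-- weight sums over the states at level n+1 are cubic forms in those at level n.  Evaluating these
-- forms on the 5³·2³ combinations of states and special edges, with the sums over the three states
-- that separate one outmost vertex equal, gives the stated polynomials.

open import Algebra.Bundles using (CommutativeRing; CommutativeSemiring)
open import Algebra.Bundles.Raw using (RawSemiring)
import Algebra.Definitions.RawSemiring as RawSemiringDefs
import Algebra.Properties.CommutativeSemigroup as CommutativeSemigroupₚ
import Algebra.Properties.Group as Groupₚ
import Algebra.Properties.Semiring.Exp as Exp
import Algebra.Properties.Semiring.Mult as Mult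
import Algebra.Solver.Ring.NaturalCoefficients.Default as Solver
open import Data.Bool.Base using (Bool; true; false; if_then_else_; _∧_; _∨_; not)
open import Data.Fin.Base using (Fin; zero; suc; combine; remQuot)
open import Data.Fin.Patterns using (0F; 1F; 2F; 3F; 4F; 5F)
open import Data.Fin.Properties using (_≟_; remQuot-combine; combine-surjective)
open import Data.Fin.Subset using (Subset; Side; inside; outside; ∣_∣; ⊤)
open import Data.List.Base as List using (List; []; _∷_; foldr; length; deduplicate; allFin)
open import Data.List.Membership.Propositional.Properties using (∈-allFin)
import Data.List.Membership.Setoid as Membership
import Data.List.Membership.Setoid.Properties as Membershipₚ
open import Data.List.Properties using (length-++; length-map; length-tabulate; map-∘)
import Data.List.Relation.Binary.Permutation.Setoid as Permutation
import Data.List.Relation.Binary.Permutation.Setoid.Properties as Permutationₚ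
open import Data.List.Relation.Unary.All as All using (All; []; _∷_)
import Data.List.Relation.Unary.All.Properties as Allₚ
open import Data.List.Relation.Unary.AllPairs as AllPairs using ([]; _∷_)
import Data.List.Relation.Unary.AllPairs.Properties as AllPairsₚ
open import Data.List.Relation.Unary.Any as Any using (Any; here; there)
import Data.List.Relation.Unary.Any.Properties as Anyₚ
open import Data.List.Relation.Unary.Enumerates.Setoid using (IsEnumeration)
open import Data.List.Relation.Unary.Enumerates.Setoid.Properties using (deduplicate⁺)
open import Data.List.Relation.Unary.Unique.DecSetoid.Properties using (deduplicate-!)
open import Data.List.Relation.Unary.Unique.Propositional.Properties using (allFin⁺)
open import Data.List.Relation.Unary.Unique.Setoid using (Unique)
import Data.List.Relation.Unary.Unique.Setoid.Properties as Uniqueₚ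
open import Data.Nat.Base as ℕ using (ℕ; suc; zero; NonZero; _∸_; _≤_; z≤n; s≤s)
import Data.Nat.Properties as ℕₚ
import Data.Nat.Solver
open import Data.Product.Base using (_×_; _,_; ∃; ∃₂; map)
open import Data.Sum.Base using (_⊎_; inj₁; inj₂)
open import Data.Vec.Base as Vec using (Vec; []; _∷_; lookup; _++_; here; there)
open import Data.Vec.Properties using (lookup-map)
open import Defs hiding (Connected; connected?)
open import Function.Base using (_∘_; id)
import Level
open import Relation.Binary.Bundles using (Setoid; DecSetoid)
open import Relation.Binary.Core using (Rel; _⇒_)
import Relation.Binary.Construct.Closure.Equivalence as Eq
open import Relation.Binary.Construct.Closure.ReflexiveTransitive using (ε; _◅_; _◅◅_)
open import Relation.Binary.Construct.Closure.Symmetric using (fwd; bwd)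
open import Relation.Binary.PropositionalEquality as ≡ using (_≡_; refl; sym; trans; cong; cong₂; subst)
import Relation.Binary.Reasoning.Setoid as SetoidReasoning
open import Relation.Binary.Structures using (IsEquivalence)
open import Relation.Nullary using (¬_; Dec; yes; no; does; proof; Reflects; ofʸ; ofⁿ; contradiction)
open import Relation.Nullary.Decidable using (True; toWitness)
open import Relation.Nullary.Reflects using (_×-reflects_; _⊎-reflects_; det)

module ℕ-Solver = Data.Nat.Solver.+-*-Solver
open ℕ-Solver using () renaming (solve to ℕ-solve)

-- Transversals of an equivalence relation

module _ {c ℓ} (S : Setoid c ℓ) where
  open Setoid S renaming (sym to ≈-sym; trans to ≈-trans)
  open Membership S using (_∈_)
  open Permutation S using (_↭_; ↭-trans; ↭-sym)
  open Permutationₚ S using (≋⇒↭; shift; ∈-resp-↭; Unique-resp-↭; xs↭ys⇒|xs|≡|ys|)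

  -- Components are counted through arbitrary systems of representatives, so that each count can use
  -- the most convenient one and not only the one that deduplication yields.
  record Transversal (ts : List Carrier) : Set (c Level.⊔ ℓ) where
    field
      unique   : Unique S ts
      covering : IsEnumeration S ts
  open Transversal

  -- Membership and permutation are both taken up to `_≈_`: the entry equivalent to `v` moves to the
  -- front and is replaced there by `v`.
  ∈⇒↭∷ : ∀ {v xs} → v ∈ xs → ∃ λ ys → xs ↭ v ∷ ys
  ∈⇒↭∷ v∈xs with ys , zs , w , v≈w , xs≋ ← Membershipₚ.∈-∃++ S v∈xs =
    ys List.++ zs , ↭-trans (≋⇒↭ xs≋) (shift (≈-sym v≈w) ys zs)

  -- Pigeonhole: the partner of the head of `us` is removed from `vs`; the other entries of `us` are
  -- inequivalent to the head, so their partners survive the removal.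
  unique⇒length≤ : ∀ {us vs} → Unique S us → All (_∈ vs) us → length us ≤ length vs
  unique⇒length≤ []            []              = z≤n
  unique⇒length≤ (u∉us ∷ us!) (u∈vs ∷ us⊆vs) with rest , vs↭ ← ∈⇒↭∷ u∈vs =
    subst (suc _ ≤_) (sym (xs↭ys⇒|xs|≡|ys| vs↭))
      (s≤s (unique⇒length≤ us! (All.zipWith (λ (u≉w , w∈vs) → Any.tail (u≉w ∘ ≈-sym) (∈-resp-↭ vs↭ w∈vs)) (u∉us , us⊆vs))))

  transversal-length : ∀ {us vs} → Transversal us → Transversal vs → length us ≡ length vs
  transversal-length us vs = ℕₚ.≤-antisym (≤ us vs) (≤ vs us)
    where
    ≤ : ∀ {us vs} → Transversal us → Transversal vs → length us ≤ length vs
    ≤ us vs = unique⇒length≤ (unique us) (All.universal (covering vs) _)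

  -- A class may be represented by any prescribed member of it; `κ-∷` prescribes an end of the new
  -- edge.
  transversal-∷ : ∀ {v ts} → Transversal ts → ∃ λ us → Transversal (v ∷ us) × length ts ≡ suc (length us)
  transversal-∷ {v} {ts} t with us , ts↭ ← ∈⇒↭∷ (covering t v) =
    us , record { unique = Unique-resp-↭ ts↭ (unique t) ; covering = λ u → ∈-resp-↭ ts↭ (covering t u) }
       , xs↭ys⇒|xs|≡|ys| ts↭

open Transversal

transversal-resp-⇔ : ∀ {c ℓ₁ ℓ₂} {X : Set c} {_≈₁_ : Rel X ℓ₁} {_≈₂_ : Rel X ℓ₂} {e₁ e₂ ts} →
                     _≈₁_ ⇒ _≈₂_ → _≈₂_ ⇒ _≈₁_ →
                     Transversal record { _≈_ = _≈₁_ ; isEquivalence = e₁ } ts →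
                     Transversal record { _≈_ = _≈₂_ ; isEquivalence = e₂ } ts
transversal-resp-⇔ to from t = record
  { unique   = AllPairs.map (_∘ from) (unique t)
  ; covering = λ u → Any.map to (covering t u)
  }

-- Components under the addition of single edges

loss : Side → Bool → ℕ
loss s t = if s ∧ not t then 1 else 0

loss+∣A∣≤ : ∀ {m} s t (A : Subset m) → loss s t ℕ.+ ∣ A ∣ ≤ ∣ s ∷ A ∣
loss+∣A∣≤ outside t     A = ℕₚ.≤-refl
loss+∣A∣≤ inside  true  A = ℕₚ.n≤1+n ∣ A ∣
loss+∣A∣≤ inside  false A = ℕₚ.≤-refl

module _ {v : ℕ} where
  open Connectivity {v} using (Adjacent; Connected; connected?; weaken; strengthen; via⇒; via⇐)

  Edges : ℕ → Set
  Edges m = Vec (Fin v × Fin v) m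

  decSetoid : ∀ {m} → Edges m → Subset m → DecSetoid _ _
  decSetoid es A = record
    { isDecEquivalence = record { isEquivalence = Eq.isEquivalence (Adjacent es A) ; _≟_ = connected? es A } }

  setoid : ∀ {m} → Edges m → Subset m → Setoid _ _
  setoid es A = DecSetoid.setoid (decSetoid es A)

  κ : ∀ {m} → Edges m → Subset m → ℕ
  κ es A = components record { ends = es } A

  representatives : ∀ {m} → Edges m → Subset m → List (Fin v)
  representatives es A = deduplicate (connected? es A) (allFin v)

  representatives-transversal : ∀ {m} (es : Edges m) A → Transversal (setoid es A) (representatives es A)
  representatives-transversal es A = record
    { unique   = deduplicate-! (decSetoid es A) (allFin v)
    ; covering = deduplicate⁺ (decSetoid es A) λ u → Any.map (λ { refl → ε }) (∈-allFin u)
    }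

  transversal⇒κ : ∀ {m} (es : Edges m) A {ts} → Transversal (setoid es A) ts → κ es A ≡ length ts
  transversal⇒κ es A = transversal-length (setoid es A) (representatives-transversal es A)

  κ-resp-⇔ : ∀ {m n} (es : Edges m) A (fs : Edges n) B →
             Connected es A ⇒ Connected fs B → Connected fs B ⇒ Connected es A → κ es A ≡ κ fs B
  κ-resp-⇔ es A fs B to from = sym (transversal⇒κ fs B (transversal-resp-⇔ to from (representatives-transversal es A)))

  edgeless⇒≡ : ∀ {u w} → Connected [] [] u w → u ≡ w
  edgeless⇒≡ ε                  = refl
  edgeless⇒≡ (fwd (() , _) ◅ _)
  edgeless⇒≡ (bwd (() , _) ◅ _)

  κ-[] : κ [] [] ≡ v
  κ-[] = trans (transversal⇒κ [] [] record
    { unique   = AllPairs.map (_∘ edgeless⇒≡) (allFin⁺ v)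
    ; covering = λ u → Any.map (λ { refl → ε }) (∈-allFin u)
    }) (length-tabulate id)

  -- If the edge is absent, or its ends are already connected, the connectivity relation does not
  -- change. Otherwise the classes of `a` and `b` merge: in a transversal that represents the class
  -- of `b` by `b`, dropping `b` leaves a transversal of the new relation.
  κ-∷ : ∀ {m} a b (es : Edges m) s A →
        loss s (does (connected? es A a b)) ℕ.+ κ ((a , b) ∷ es) (s ∷ A) ≡ κ es A
  κ-∷ a b es outside A = κ-resp-⇔ ((a , b) ∷ es) (outside ∷ A) es A strengthen weaken
  κ-∷ a b es inside  A with connected? es A a b
  ... | yes a~b = κ-resp-⇔ ((a , b) ∷ es) (inside ∷ A) es A (reroute ∘ via⇐) weaken
    where
    reroute : ∀ {u w} → Connectivity.Via (a , b) es A u w → Connected es A u w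
    reroute (inj₁ p)              = p
    reroute (inj₂ (inj₁ (p , q))) = p ◅◅ a~b ◅◅ q
    reroute (inj₂ (inj₂ (p , q))) = p ◅◅ Eq.symmetric _ a~b ◅◅ q
  ... | no a≁b
    with us , t , length≡ ← transversal-∷ (setoid es A) {b} (representatives-transversal es A)
    with b≁us ∷ us! ← unique t = trans (cong suc (transversal⇒κ ((a , b) ∷ es) (inside ∷ A) t′)) (sym length≡)
    where
    separated : ∀ {xs} → All (λ x → ¬ Connected es A b x) xs → Unique (setoid es A) xs →
                Unique (setoid ((a , b) ∷ es) (inside ∷ A)) xs
    separated []              []           = []
    separated (b≁x ∷ b≁xs) (x≁xs ∷ xs!) = All.zipWith apart (b≁xs , x≁xs) ∷ separated b≁xs xs!
      where
      apart : ∀ {w} → ¬ Connected es A b w × ¬ Connected es A _ w → ¬ Connected ((a , b) ∷ es) (inside ∷ A) _ w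
      -- A path through the new edge has one of its two vertices on the side of `b`, whose class is
      -- no longer represented.
      apart (b≁w , x≁w) x~w with via⇐ x~w
      ... | inj₁ p              = x≁w p
      ... | inj₂ (inj₁ (_ , q)) = b≁w q
      ... | inj₂ (inj₂ (p , _)) = b≁x (Eq.symmetric _ p)

    covers : IsEnumeration (setoid ((a , b) ∷ es) (inside ∷ A)) us
    -- A vertex formerly represented by `b` now has the representative of `a`, which lies in `us`
    -- because `a` was not connected to `b`.
    covers u with covering t u
    ... | there u∈us = Any.map weaken u∈us
    ... | here u~b   with covering t a
    ...   | here a~b   = contradiction a~b a≁b
    ...   | there a∈us = Any.map (λ a~w → via⇒ (inj₂ (inj₂ (u~b , a~w)))) a∈us

    t′ : Transversal (setoid ((a , b) ∷ es) (inside ∷ A)) us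
    t′ = record { unique = separated b≁us us! ; covering = covers }

  κ≤v : ∀ {m} (es : Edges m) A → κ es A ≤ v
  κ≤v []             []      = ℕₚ.≤-reflexive κ-[]
  κ≤v ((a , b) ∷ es) (s ∷ A) = ℕₚ.≤-trans
    (ℕₚ.≤-trans (ℕₚ.m≤n+m _ _) (ℕₚ.≤-reflexive (κ-∷ a b es s A))) (κ≤v es A)

  -- One edge costs at most one component, and without edges there are `v` of them. With `κ≤v` this
  -- makes the truncated subtractions in `rank` and `nullity` exact.
  v≤∣A∣+κ : ∀ {m} (es : Edges m) A → v ≤ ∣ A ∣ ℕ.+ κ es A
  v≤∣A∣+κ []             []      = ℕₚ.≤-reflexive (sym κ-[])
  v≤∣A∣+κ ((a , b) ∷ es) (s ∷ A) = begin
    v                                 ≤⟨ v≤∣A∣+κ es A ⟩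
    ∣ A ∣ ℕ.+ κ es A                  ≡⟨ cong (∣ A ∣ ℕ.+_) (κ-∷ a b es s A) ⟨
    ∣ A ∣ ℕ.+ (l ℕ.+ k)               ≡⟨ ℕₚ.+-assoc ∣ A ∣ l k ⟨
    ∣ A ∣ ℕ.+ l ℕ.+ k                 ≡⟨ cong (ℕ._+ k) (ℕₚ.+-comm ∣ A ∣ l) ⟩
    l ℕ.+ ∣ A ∣ ℕ.+ k                 ≤⟨ ℕₚ.+-monoˡ-≤ k (loss+∣A∣≤ s _ A) ⟩
    ∣ s ∷ A ∣ ℕ.+ k                   ∎
    where
    open ℕₚ.≤-Reasoning
    l = loss s (does (connected? es A a b))
    k = κ ((a , b) ∷ es) (s ∷ A)

  -- Adjacency in concatenated and relabelled edge lists

  Adjacent-++⁺ˡ : ∀ {m n} (es : Edges m) (fs : Edges n) {A B} → Adjacent es A ⇒ Adjacent (es ++ fs) (A ++ B)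
  Adjacent-++⁺ˡ (e ∷ es) fs {s ∷ A} (zero  , here      , eq) = zero , here , eq
  Adjacent-++⁺ˡ (e ∷ es) fs {s ∷ A} (suc i , there i∈A , eq)
    with j , j∈A , eq′ ← Adjacent-++⁺ˡ es fs (i , i∈A , eq) = suc j , there j∈A , eq′

  Adjacent-++⁺ʳ : ∀ {m n} (es : Edges m) (fs : Edges n) {A B} → Adjacent fs B ⇒ Adjacent (es ++ fs) (A ++ B)
  Adjacent-++⁺ʳ []       fs {[]}    adj = adj
  Adjacent-++⁺ʳ (e ∷ es) fs {s ∷ A} adj with j , j∈A , eq ← Adjacent-++⁺ʳ es fs adj = suc j , there j∈A , eq

  Adjacent-++⁻ : ∀ {m n} (es : Edges m) (fs : Edges n) {A B u w} →
                 Adjacent (es ++ fs) (A ++ B) u w → Adjacent es A u w ⊎ Adjacent fs B u w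
  Adjacent-++⁻ []       fs {[]}    adj                      = inj₂ adj
  Adjacent-++⁻ (e ∷ es) fs {s ∷ A} (zero  , here      , eq) = inj₁ (zero , here , eq)
  Adjacent-++⁻ (e ∷ es) fs {s ∷ A} (suc i , there i∈A , eq) with Adjacent-++⁻ es fs (i , i∈A , eq)
  ... | inj₁ (j , j∈A , eq′) = inj₁ (suc j , there j∈A , eq′)
  ... | inj₂ adj             = inj₂ adj

module _ {v v′ : ℕ} (f : Fin v → Fin v′) where
  open Connectivity using (Adjacent)

  Adjacent-map⁺ : ∀ {m} (es : Edges m) {A u w} → Adjacent es A u w → Adjacent (Vec.map (map f f) es) A (f u) (f w)
  Adjacent-map⁺ es (i , i∈A , eq) = i , i∈A , trans (lookup-map i (map f f) es) (cong (map f f) eq)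

  Adjacent-map⁻ : ∀ {m} (es : Edges m) {A x y} → Adjacent (Vec.map (map f f) es) A x y →
                  ∃₂ λ u w → Adjacent es A u w × f u ≡ x × f w ≡ y
  Adjacent-map⁻ es (i , i∈A , eq) with refl ← trans (sym (lookup-map i (map f f) es)) eq =
    _ , _ , (i , i∈A , refl) , refl , refl

-- The disjoint union of three copies

module ThreeCopies {v m : ℕ} (es : Edges {v} m) where
  open Connectivity using (Adjacent; Connected)

  inject : Fin 3 → Fin v → Fin (3 ℕ.* v)
  inject = combine {3}

  copy : Fin 3 → Edges {3 ℕ.* v} m
  copy i = Vec.map (map (inject i) (inject i)) es

  copies : Edges {3 ℕ.* v} (m ℕ.+ (m ℕ.+ m))
  copies = copy 0F ++ (copy 1F ++ copy 2F)

  module _ (A : Fin 3 → Subset m) where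
    union : Subset (m ℕ.+ (m ℕ.+ m))
    union = A 0F ++ (A 1F ++ A 2F)

    data WithinCopy : Fin 3 × Fin v → Fin 3 × Fin v → Set where
      within : ∀ {i u w} → Connected es (A i) u w → WithinCopy (i , u) (i , w)

    same-copy : ∀ {i j u w} → WithinCopy (i , u) (j , w) → i ≡ j
    same-copy (within _) = refl

    connected-within : ∀ {i u w} → WithinCopy (i , u) (i , w) → Connected es (A i) u w
    connected-within (within p) = p

    WithinCopy-isEquivalence : IsEquivalence WithinCopy
    WithinCopy-isEquivalence = record
      { refl  = within ε
      ; sym   = λ { (within p) → within (Eq.symmetric _ p) }
      ; trans = λ { (within p) (within q) → within (p ◅◅ q) }
      }

    Adjacent-copy⁺ : ∀ i {u w} → Adjacent es (A i) u w → Adjacent copies union (inject i u) (inject i w)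
    Adjacent-copy⁺ 0F adj = Adjacent-++⁺ˡ (copy 0F) (copy 1F ++ copy 2F) (Adjacent-map⁺ (inject 0F) es adj)
    Adjacent-copy⁺ 1F adj = Adjacent-++⁺ʳ (copy 0F) (copy 1F ++ copy 2F) {A 0F}
      (Adjacent-++⁺ˡ (copy 1F) (copy 2F) (Adjacent-map⁺ (inject 1F) es adj))
    Adjacent-copy⁺ 2F adj = Adjacent-++⁺ʳ (copy 0F) (copy 1F ++ copy 2F) {A 0F}
      (Adjacent-++⁺ʳ (copy 1F) (copy 2F) {A 1F} (Adjacent-map⁺ (inject 2F) es adj))

    Adjacent-copy⁻ : ∀ i {x y} → Adjacent (copy i) (A i) x y → WithinCopy (remQuot v x) (remQuot v y)
    Adjacent-copy⁻ i adj with u , w , u∼w , refl , refl ← Adjacent-map⁻ (inject i) es adj =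
      ≡.subst₂ WithinCopy (sym (remQuot-combine i u)) (sym (remQuot-combine i w)) (within (Eq.return u∼w))

    Adjacent-copies⁻ : ∀ {x y} → Adjacent copies union x y → WithinCopy (remQuot v x) (remQuot v y)
    Adjacent-copies⁻ adj with Adjacent-++⁻ (copy 0F) (copy 1F ++ copy 2F) {A 0F} adj
    ... | inj₁ adj₀ = Adjacent-copy⁻ 0F adj₀
    ... | inj₂ adj₁₂ with Adjacent-++⁻ (copy 1F) (copy 2F) {A 1F} adj₁₂
    ...   | inj₁ adj₁ = Adjacent-copy⁻ 1F adj₁
    ...   | inj₂ adj₂ = Adjacent-copy⁻ 2F adj₂

    connected-copy⁺ : ∀ i {u w} → Connected es (A i) u w → Connected copies union (inject i u) (inject i w)
    connected-copy⁺ i = Eq.gmap (inject i) (Adjacent-copy⁺ i)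

    -- No path leaves its copy: every adjacency decodes under `remQuot` into `WithinCopy`, and since
    -- `WithinCopy` is an equivalence, so does the whole closure.
    connected-copies⁻ : ∀ i j {u w} → Connected copies union (inject i u) (inject j w) → WithinCopy (i , u) (j , w)
    connected-copies⁻ i j {u} {w} p = ≡.subst₂ WithinCopy (remQuot-combine i u) (remQuot-combine j w)
      (Eq.gfold WithinCopy-isEquivalence (remQuot v) Adjacent-copies⁻ p)

    -- The representatives of the three copies, injected and concatenated, form a transversal of the
    -- union.
    κ-copies : κ copies union ≡ κ es (A 0F) ℕ.+ (κ es (A 1F) ℕ.+ κ es (A 2F))
    κ-copies = trans (transversal⇒κ copies union record { unique = all-unique ; covering = all-covering }) length≡
      where
      reps : Fin 3 → List (Fin v)
      reps i = representatives es (A i)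

      rs : Fin 3 → List (Fin (3 ℕ.* v))
      rs i = List.map (inject i) (reps i)

      all : List (Fin (3 ℕ.* v))
      all = rs 0F List.++ (rs 1F List.++ rs 2F)

      length≡ : length all ≡ κ es (A 0F) ℕ.+ (κ es (A 1F) ℕ.+ κ es (A 2F))
      length≡ = trans (length-++ (rs 0F)) (cong₂ ℕ._+_ (length-map _ (reps 0F))
        (trans (length-++ (rs 1F)) (cong₂ ℕ._+_ (length-map _ (reps 1F)) (length-map _ (reps 2F)))))

      copy-unique : ∀ i → Unique (setoid copies union) (rs i)
      copy-unique i = Uniqueₚ.map⁺ (setoid es (A i)) (setoid copies union)
        (λ p → connected-within (connected-copies⁻ i i p)) (unique (representatives-transversal es (A i)))

      apart : ∀ i j → ¬ i ≡ j → All (λ x → All (λ y → ¬ Connected copies union x y) (rs j)) (rs i)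
      apart i j i≢j = Allₚ.map⁺ (All.universal (λ u → Allₚ.map⁺ (All.universal
        (λ w p → i≢j (same-copy (connected-copies⁻ i j {u} {w} p))) (reps j))) (reps i))

      all-unique : Unique (setoid copies union) all
      all-unique = AllPairsₚ.++⁺ (copy-unique 0F)
        (AllPairsₚ.++⁺ (copy-unique 1F) (copy-unique 2F) (apart 1F 2F (λ ())))
        (All.zipWith (λ (p , q) → Allₚ.++⁺ p q) (apart 0F 1F (λ ()) , apart 0F 2F (λ ())))

      copy-covering : ∀ i u → Any (Connected copies union (inject i u)) (rs i)
      copy-covering i u = Anyₚ.map⁺ (Any.map (connected-copy⁺ i) (covering (representatives-transversal es (A i)) u))

      inject-covering : ∀ i u → Any (Connected copies union (inject i u)) all
      inject-covering 0F u = Anyₚ.++⁺ˡ (copy-covering 0F u)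
      inject-covering 1F u = Anyₚ.++⁺ʳ (rs 0F) (Anyₚ.++⁺ˡ (copy-covering 1F u))
      inject-covering 2F u = Anyₚ.++⁺ʳ (rs 0F) (Anyₚ.++⁺ʳ (rs 1F) (copy-covering 2F u))

      all-covering : IsEnumeration (setoid copies union) all
      all-covering x with i , u , refl ← combine-surjective {3} {v} x = inject-covering i u

-- The partition of the outmost vertices

data Corner : Set where
  T L R : Corner

data State : Set where
  TLR T∣LR TL∣R TR∣L T∣L∣R : State

joinedTL joinedLR joinedTR : State → Bool
joinedTL TLR  = true
joinedTL TL∣R = true
joinedTL _    = false
joinedLR TLR  = true
joinedLR T∣LR = true
joinedLR _    = false
joinedTR TLR  = true
joinedTR TR∣L = true
joinedTR _    = false

joined : State → Corner → Corner → Bool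
joined s T L = joinedTL s
joined s L T = joinedTL s
joined s L R = joinedLR s
joined s R L = joinedLR s
joined s T R = joinedTR s
joined s R T = joinedTR s
joined s _ _ = true

-- The arguments tell whether top–left, left–right and top–right are joined; triples that
-- violate transitivity get a junk value.
classify : Bool → Bool → Bool → State
classify true  true  _     = TLR
classify false true  _     = T∣LR
classify true  false _     = TL∣R
classify false false true  = TR∣L
classify false false false = T∣L∣R

Reflects-map : ∀ {a b t} {A : Set a} {B : Set b} → (A → B) → (B → A) → Reflects A t → Reflects B t
Reflects-map to from (ofʸ a)  = ofʸ (to a)
Reflects-map to from (ofⁿ ¬a) = ofⁿ (¬a ∘ from)

module Outmost (G : OutmostGraph) where
  open OutmostGraph G
  open Connectivity {#V} using (Connected; connected?)

  corner : Corner → Fin #V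
  corner T = top
  corner L = left
  corner R = right

  module _ (A : Subset #E) where
    private
      _~_ : Corner → Corner → Set
      p ~ q = Connected ends A (corner p) (corner q)

      _~?_ : ∀ p q → Dec (p ~ q)
      p ~? q = connected? ends A (corner p) (corner q)

    state : State
    state = classify (does (T ~? L)) (does (L ~? R)) (does (T ~? R))

    private
      -- Transitivity excludes that exactly two of the three pairs are connected, so the junk values
      -- of `classify` never arise.
      three : (tl : Dec (T ~ L)) (lr : Dec (L ~ R)) (tr : Dec (T ~ R)) →
              let s = classify (does tl) (does lr) (does tr) in
              Reflects (T ~ L) (joinedTL s) × Reflects (L ~ R) (joinedLR s) × Reflects (T ~ R) (joinedTR s)
      three (yes p) (yes q) _       = ofʸ p , ofʸ q , ofʸ (p ◅◅ q)
      three (no ¬p) (yes q) (yes r) = contradiction (r ◅◅ Eq.symmetric _ q) ¬p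
      three (no ¬p) (yes q) (no ¬r) = ofⁿ ¬p , ofʸ q , ofⁿ ¬r
      three (yes p) (no ¬q) (yes r) = contradiction (Eq.symmetric _ p ◅◅ r) ¬q
      three (yes p) (no ¬q) (no ¬r) = ofʸ p , ofⁿ ¬q , ofⁿ ¬r
      three (no ¬p) (no ¬q) (yes r) = ofⁿ ¬p , ofⁿ ¬q , ofʸ r
      three (no ¬p) (no ¬q) (no ¬r) = ofⁿ ¬p , ofⁿ ¬q , ofⁿ ¬r

      flip : ∀ {u w t} → Reflects (Connected ends A u w) t → Reflects (Connected ends A w u) t
      flip = Reflects-map (Eq.symmetric _) (Eq.symmetric _)

    joined-reflects : ∀ p q → Reflects (p ~ q) (joined state p q)
    joined-reflects p q with three (T ~? L) (L ~? R) (T ~? R) | p | q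
    ... | tl , lr , tr | T | T = ofʸ ε
    ... | tl , lr , tr | T | L = tl
    ... | tl , lr , tr | T | R = tr
    ... | tl , lr , tr | L | T = flip tl
    ... | tl , lr , tr | L | L = ofʸ ε
    ... | tl , lr , tr | L | R = lr
    ... | tl , lr , tr | R | T = flip tr
    ... | tl , lr , tr | R | L = flip lr
    ... | tl , lr , tr | R | R = ofʸ ε

open Outmost

-- The effect of the special edges

-- (i , p) is the outmost vertex p of the copy i; the special edges join only such vertices.
Point : Set
Point = Fin 3 × Corner

specials : Vec (Point × Point) 3
specials = ((0F , L) , (1F , T)) ∷ ((0F , R) , (2F , T)) ∷ ((1F , R) , (2F , L)) ∷ []

-- The Boolean counterpart of `Via`, iterated over the chosen edges. It computes on states alone, so
-- the finitely many cases can be evaluated without reference to a graph.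
closure : ∀ {n} → Vec (Point × Point) n → Subset n → (Point → Point → Bool) → Point → Point → Bool
closure []             []            r     = r
closure (e ∷ es)       (outside ∷ S) r     = closure es S r
closure ((a , b) ∷ es) (inside ∷ S)  r x y = r′ x y ∨ (r′ x a ∧ r′ b y ∨ r′ x b ∧ r′ a y)
  where r′ = closure es S r

-- The number m of merged components. Each edge is tested against the closure under the edges behind
-- it, the order in which `κ-∷` removes edges.
merges : ∀ {n} → Vec (Point × Point) n → Subset n → (Point → Point → Bool) → ℕ
merges []             []      r = 0
merges ((a , b) ∷ es) (s ∷ S) r = merges es S r ℕ.+ loss s (closure es S r a b)

merges≤ : ∀ {n} (es : Vec (Point × Point) n) S r → merges es S r ≤ ∣ S ∣
merges≤ []             []      r = z≤n
merges≤ ((a , b) ∷ es) (s ∷ S) r = ℕₚ.≤-trans (ℕₚ.+-monoˡ-≤ _ (merges≤ es S r))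
  (ℕₚ.≤-trans (ℕₚ.≤-reflexive (ℕₚ.+-comm ∣ S ∣ _)) (loss+∣A∣≤ s (closure es S r a b) S))

module _ {v m} (pt : Point → Fin v) (es : Edges {v} m) (A : Subset m) {r : Point → Point → Bool}
         (r-reflects : ∀ x y → Reflects (Connectivity.Connected es A (pt x) (pt y)) (r x y)) where
  open Connectivity {v}

  closure-reflects : ∀ {n} (fs : Vec (Point × Point) n) S x y →
    Reflects (Connected (Vec.map (map pt pt) fs ++ es) (S ++ A) (pt x) (pt y)) (closure fs S r x y)
  closure-reflects []             []            x y = r-reflects x y
  closure-reflects (f ∷ fs)       (outside ∷ S) x y = Reflects-map weaken strengthen (closure-reflects fs S x y)
  closure-reflects ((a , b) ∷ fs) (inside ∷ S)  x y = Reflects-map via⇒ via⇐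
    (r′ x y ⊎-reflects ((r′ x a ×-reflects r′ b y) ⊎-reflects (r′ x b ×-reflects r′ a y)))
    where r′ = closure-reflects fs S

  -- The identities `κ-∷` telescope. Their losses are stated with the decision `connected?`, those
  -- of `merges` with `closure`; `det` identifies the two, since both reflect the same connectivity.
  κ-merges : ∀ {n} (fs : Vec (Point × Point) n) S →
    merges fs S r ℕ.+ κ (Vec.map (map pt pt) fs ++ es) (S ++ A) ≡ κ es A
  κ-merges []             []      = refl
  κ-merges ((a , b) ∷ fs) (s ∷ S) = trans (ℕₚ.+-assoc (merges fs S r) _ _)
    (trans (cong (merges fs S r ℕ.+_) (trans (cong (λ t → loss s t ℕ.+ _)
              (det (closure-reflects fs S a b) (proof (connected? (Vec.map (map pt pt) fs ++ es) (S ++ A) (pt a) (pt b)))))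
              (κ-∷ (pt a) (pt b) (Vec.map (map pt pt) fs ++ es) s (S ++ A))))
           (κ-merges fs S))

triple : ∀ {a} {X : Set a} → X → X → X → Fin 3 → X
triple x₁ x₂ x₃ = lookup (x₁ ∷ x₂ ∷ x₃ ∷ [])

disjoint : (Fin 3 → State) → Point → Point → Bool
disjoint s (i , p) (j , q) = does (i ≟ j) ∧ joined (s i) p q

glueState : State → State → State → Subset 3 → State
glueState s₁ s₂ s₃ S = classify (r (0F , T) (1F , L)) (r (1F , L) (2F , R)) (r (0F , T) (2F , R))
  where r = closure specials S (disjoint (triple s₁ s₂ s₃))

glueMerges : State → State → State → Subset 3 → ℕ
glueMerges s₁ s₂ s₃ S = merges specials S (disjoint (triple s₁ s₂ s₃))

∣++∣ : ∀ {m n} (A : Subset m) (B : Subset n) → ∣ A ++ B ∣ ≡ ∣ A ∣ ℕ.+ ∣ B ∣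
∣++∣ []            B = refl
∣++∣ (outside ∷ A) B = ∣++∣ A B
∣++∣ (inside ∷ A)  B = cong suc (∣++∣ A B)

⊤-++ : ∀ m {n} → ⊤ {m} ++ ⊤ {n} ≡ ⊤
⊤-++ zero    = refl
⊤-++ (suc m) = cong (inside ∷_) (⊤-++ m)

-- State and component count of a glued subgraph

module Glue (G : OutmostGraph) where
  open OutmostGraph G
  open ThreeCopies ends
  open Connectivity using (Adjacent; Connected; connected?)
  open OutmostGraph (glue G) using () renaming (ends to glueEnds)

  point : Point → Fin (3 ℕ.* #V)
  point (i , p) = inject i (corner G p)

  specialEdges : Edges {3 ℕ.* #V} 3
  specialEdges = Vec.map (map point point) specials

  module _ (A₁ A₂ A₃ : Subset #E) (S : Subset 3) where
    private
      A = triple A₁ A₂ A₃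
      s₁ = state G A₁
      s₂ = state G A₂
      s₃ = state G A₃
      s = triple s₁ s₂ s₃

    glued : Subset (#E ℕ.+ (#E ℕ.+ (#E ℕ.+ 3)))
    glued = A₁ ++ (A₂ ++ (A₃ ++ S))

    disjoint-reflects : ∀ x y → Reflects (Connected copies (union A) (point x) (point y)) (disjoint s x y)
    disjoint-reflects (i , p) (j , q) with i ≟ j
    ... | no i≢j   = ofⁿ (i≢j ∘ same-copy A ∘ connected-copies⁻ A i j)
    ... | yes refl = Reflects-map (connected-copy⁺ A i) (connected-within A ∘ connected-copies⁻ A i i) (in-copy i)
      where
      in-copy : ∀ i → Reflects (Connected ends (A i) (corner G p) (corner G q)) (joined (s i) p q)
      in-copy 0F = joined-reflects G A₁ p q
      in-copy 1F = joined-reflects G A₂ p q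
      in-copy 2F = joined-reflects G A₃ p q

    -- κ-∷ adds edges at the front, so the special edges are moved there.
    reorder : Adjacent glueEnds glued ⇒ Adjacent (specialEdges ++ copies) (S ++ union A)
    reorder adj with Adjacent-++⁻ (copy 0F) (copy 1F ++ (copy 2F ++ specialEdges)) {A₁} adj
    ... | inj₁ adj₁ = Adjacent-++⁺ʳ specialEdges copies {S} (Adjacent-++⁺ˡ (copy 0F) (copy 1F ++ copy 2F) adj₁)
    ... | inj₂ adj₂ with Adjacent-++⁻ (copy 1F) (copy 2F ++ specialEdges) {A₂} adj₂
    ...   | inj₁ adj₁ = Adjacent-++⁺ʳ specialEdges copies {S} (Adjacent-++⁺ʳ (copy 0F) (copy 1F ++ copy 2F) {A₁}
                          (Adjacent-++⁺ˡ (copy 1F) (copy 2F) adj₁))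
    ...   | inj₂ adj₂ with Adjacent-++⁻ (copy 2F) specialEdges {A₃} adj₂
    ...     | inj₁ adj₁ = Adjacent-++⁺ʳ specialEdges copies {S} (Adjacent-++⁺ʳ (copy 0F) (copy 1F ++ copy 2F) {A₁}
                            (Adjacent-++⁺ʳ (copy 1F) (copy 2F) {A₂} adj₁))
    ...     | inj₂ adj₂ = Adjacent-++⁺ˡ specialEdges copies adj₂

    reorder⁻ : Adjacent (specialEdges ++ copies) (S ++ union A) ⇒ Adjacent glueEnds glued
    reorder⁻ adj with Adjacent-++⁻ specialEdges copies {S} adj
    ... | inj₁ adj₁ = Adjacent-++⁺ʳ (copy 0F) (copy 1F ++ (copy 2F ++ specialEdges)) {A₁}
                        (Adjacent-++⁺ʳ (copy 1F) (copy 2F ++ specialEdges) {A₂} (Adjacent-++⁺ʳ (copy 2F) specialEdges {A₃} adj₁))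
    ... | inj₂ adj₂ with Adjacent-++⁻ (copy 0F) (copy 1F ++ copy 2F) {A₁} adj₂
    ...   | inj₁ adj₁ = Adjacent-++⁺ˡ (copy 0F) (copy 1F ++ (copy 2F ++ specialEdges)) adj₁
    ...   | inj₂ adj₂ with Adjacent-++⁻ (copy 1F) (copy 2F) {A₂} adj₂
    ...     | inj₁ adj₁ = Adjacent-++⁺ʳ (copy 0F) (copy 1F ++ (copy 2F ++ specialEdges)) {A₁}
                            (Adjacent-++⁺ˡ (copy 1F) (copy 2F ++ specialEdges) adj₁)
    ...     | inj₂ adj₂ = Adjacent-++⁺ʳ (copy 0F) (copy 1F ++ (copy 2F ++ specialEdges)) {A₁}
                            (Adjacent-++⁺ʳ (copy 1F) (copy 2F ++ specialEdges) {A₂} (Adjacent-++⁺ˡ (copy 2F) specialEdges adj₂))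

    glue-connected : ∀ x y → does (connected? glueEnds glued (point x) (point y))
                           ≡ closure specials S (disjoint s) x y
    glue-connected x y = det (proof (connected? glueEnds glued (point x) (point y)))
      (Reflects-map (Eq.map reorder⁻) (Eq.map reorder)
        (closure-reflects point copies (union A) disjoint-reflects specials S x y))

    glue-state : state (glue G) glued ≡ glueState s₁ s₂ s₃ S
    -- The top, left and right vertices of `glue G` are by definition the points (0F , T), (1F , L)
    -- and (2F , R).
    glue-state rewrite glue-connected (0F , T) (1F , L)
                     | glue-connected (1F , L) (2F , R)
                     | glue-connected (0F , T) (2F , R) = refl

    -- The special edges are added to the disjoint union, whose components are counted copy by copy.
    glue-κ : glueMerges s₁ s₂ s₃ S ℕ.+ κ glueEnds glued ≡ κ ends A₁ ℕ.+ (κ ends A₂ ℕ.+ κ ends A₃)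
    glue-κ = trans (cong (glueMerges s₁ s₂ s₃ S ℕ.+_)
                     (κ-resp-⇔ glueEnds glued (specialEdges ++ copies) (S ++ union A)
                       (Eq.map reorder) (Eq.map reorder⁻)))
               (trans (κ-merges point copies (union A) disjoint-reflects specials S) (κ-copies A))

-- Connectedness of the graphs

record Spanned (G : OutmostGraph) : Set where
  open OutmostGraph G
  field
    κ-⊤     : κ ends ⊤ ≡ 1
    state-⊤ : state G ⊤ ≡ TLR
open Spanned

module _ (G : OutmostGraph) where
  open Glue G

  glued-⊤ : glued ⊤ ⊤ ⊤ ⊤ ≡ ⊤
  glued-⊤ = begin
    ⊤ {m} ++ (⊤ {m} ++ (⊤ {m} ++ ⊤ {3}))    ≡⟨ cong (λ B → ⊤ {m} ++ (⊤ {m} ++ B)) (⊤-++ m) ⟩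
    ⊤ {m} ++ (⊤ {m} ++ ⊤)                   ≡⟨ cong (⊤ {m} ++_) (⊤-++ m) ⟩
    ⊤ {m} ++ ⊤                              ≡⟨ ⊤-++ m ⟩
    ⊤                                       ∎
    where
    open ≡.≡-Reasoning
    m = OutmostGraph.#E G

  -- Connectedness is carried through the induction together with the state `TLR` of the full
  -- subgraph, because `glueMerges` and `glueState` compute once the states are known.
  glue-spanned : Spanned G → Spanned (glue G)
  -- The 2 is `glueMerges TLR TLR TLR ⊤`: of the three special edges, two join different components
  -- and the last one closes a cycle.
  glue-spanned G-spanned = record { κ-⊤ = ℕₚ.+-cancelˡ-≡ 2 _ 1 κ′ ; state-⊤ = state′ }
    where
    open OutmostGraph (glue G) using (ends)
    κ′ : 2 ℕ.+ κ ends ⊤ ≡ 3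
    κ′ = begin
      2 ℕ.+ κ ends ⊤                                   ≡⟨ cong₂ (λ s A → glueMerges s s s ⊤ ℕ.+ κ ends A) (state-⊤ G-spanned) glued-⊤ ⟨
      glueMerges s s s ⊤ ℕ.+ κ ends (glued ⊤ ⊤ ⊤ ⊤)    ≡⟨ glue-κ ⊤ ⊤ ⊤ ⊤ ⟩
      k ℕ.+ (k ℕ.+ k)                                  ≡⟨ cong (λ k → k ℕ.+ (k ℕ.+ k)) (κ-⊤ G-spanned) ⟩
      3                                                ∎
      where
      open ≡.≡-Reasoning
      s = state G ⊤
      k = κ (OutmostGraph.ends G) ⊤

    state′ : state (glue G) ⊤ ≡ TLR
    state′ = trans (cong (state (glue G)) (sym glued-⊤))
               (trans (glue-state ⊤ ⊤ ⊤ ⊤) (cong (λ s → glueState s s s ⊤) (state-⊤ G-spanned)))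

triangle-spanned : Spanned triangle
triangle-spanned = record { κ-⊤ = refl ; state-⊤ = refl }

sigma-spanned : ∀ n .{{_ : NonZero n}} → Spanned (Sigma n)
sigma-spanned (suc zero)    = triangle-spanned
sigma-spanned (suc (suc n)) = glue-spanned (Sigma (suc n)) (sigma-spanned (suc n))

-- Rank and nullity in terms of components

module _ (G : OutmostGraph) where
  open OutmostGraph G

  κ-positive : ∀ A → ∃ λ k → κ ends A ≡ suc k
  κ-positive A with representatives ends A | covering (representatives-transversal ends A) top
  ... | _ ∷ _ | _ = _ , refl

  defect : Subset #E → ℕ
  defect A = rank graph ⊤ ∸ rank graph A

  -- For connected G, r(G) - r(A) = k(A) - 1; the successor keeps the identity free of subtraction.
  suc-defect : Spanned G → ∀ A → suc (defect A) ≡ κ ends A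
  suc-defect G-spanned A with k , κ≡ ← κ-positive A = begin
    suc ((#V ∸ κ ends ⊤) ∸ (#V ∸ κ ends A))    ≡⟨ cong₂ (λ i j → suc ((#V ∸ i) ∸ (#V ∸ j))) (κ-⊤ G-spanned) κ≡ ⟩
    -- With k(A) written as `suc k`, both differences start from `#V ∸ 1`, and the double
    -- subtraction cancels because k is at most `#V ∸ 1`.
    suc ((#V ∸ 1) ∸ (#V ∸ suc k))              ≡⟨ cong (λ i → suc ((#V ∸ 1) ∸ i)) (ℕₚ.∸-+-assoc #V 1 k) ⟨
    suc ((#V ∸ 1) ∸ ((#V ∸ 1) ∸ k))            ≡⟨ cong suc (ℕₚ.m∸[m∸n]≡n k≤) ⟩
    suc k                                      ≡⟨ κ≡ ⟨
    κ ends A                                   ∎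
    where
    open ≡.≡-Reasoning
    k≤ : k ≤ #V ∸ 1
    k≤ = ℕₚ.∸-monoˡ-≤ 1 (subst (_≤ #V) κ≡ (κ≤v ends A))

  -- The additive form of n(A) = |A| - |V| + k(A), which can be summed over the copies and cancelled
  -- in ℕ.
  nullity+#V : ∀ A → nullity graph A ℕ.+ #V ≡ ∣ A ∣ ℕ.+ κ ends A
  nullity+#V A = begin
    ∣ A ∣ ∸ d ℕ.+ #V               ≡⟨ cong (∣ A ∣ ∸ d ℕ.+_) (sym #V≡) ⟩
    ∣ A ∣ ∸ d ℕ.+ (d ℕ.+ k)        ≡⟨ ℕₚ.+-assoc (∣ A ∣ ∸ d) d k ⟨
    ∣ A ∣ ∸ d ℕ.+ d ℕ.+ k          ≡⟨ cong (ℕ._+ k) (ℕₚ.m∸n+n≡m d≤∣A∣) ⟩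
    ∣ A ∣ ℕ.+ k                    ∎
    where
    open ≡.≡-Reasoning
    k = κ ends A
    d = #V ∸ k

    #V≡ : d ℕ.+ k ≡ #V
    #V≡ = ℕₚ.m∸n+n≡m (κ≤v ends A)

    d≤∣A∣ : d ≤ ∣ A ∣
    d≤∣A∣ = ℕₚ.m≤n+o⇒m∸n≤o #V k (subst (#V ≤_) (ℕₚ.+-comm ∣ A ∣ k) (v≤∣A∣+κ ends A))

-- Indicators of the states

δ : State → State → Bool
δ TLR   TLR   = true
δ T∣LR  T∣LR  = true
δ TL∣R  TL∣R  = true
δ TR∣L  TR∣L  = true
δ T∣L∣R T∣L∣R = true
δ _     _     = false

-- The left sides of this and the next two identities are what `allTogether?`, `leftRightOnly?` and
-- `allSeparate?` compute to; this links the filters defining `H₂`, `H₁`, `H₀` to states.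
δ-TLR : ∀ tl lr tr → tl ∧ lr ≡ δ (classify tl lr tr) TLR
δ-TLR true  true  _     = refl
δ-TLR true  false _     = refl
δ-TLR false true  _     = refl
δ-TLR false false true  = refl
δ-TLR false false false = refl

δ-T∣LR : ∀ tl lr tr → lr ∧ not tl ≡ δ (classify tl lr tr) T∣LR
δ-T∣LR true  true  _     = refl
δ-T∣LR true  false _     = refl
δ-T∣LR false true  _     = refl
δ-T∣LR false false true  = refl
δ-T∣LR false false false = refl

δ-T∣L∣R : ∀ tl lr tr → not tl ∧ (not tr ∧ not lr) ≡ δ (classify tl lr tr) T∣L∣R
δ-T∣L∣R true  true  _     = refl
δ-T∣L∣R true  false _     = refl
δ-T∣L∣R false true  true  = refl
δ-T∣L∣R false true  false = refl
δ-T∣L∣R false false true  = refl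
δ-T∣L∣R false false false = refl

states : List State
states = TLR ∷ T∣LR ∷ TL∣R ∷ TR∣L ∷ T∣L∣R ∷ []

-- Exponents of the weight under gluing

module _ {G : OutmostGraph} (G-spanned : Spanned G) where
  open OutmostGraph G
  open Glue G

  module _ (A₁ A₂ A₃ : Subset #E) (S : Subset 3) where
    private
      A = glued A₁ A₂ A₃ S
      m = glueMerges (state G A₁) (state G A₂) (state G A₃) S
      N = nullity graph
      k = κ ends
      N′ = nullity (OutmostGraph.graph (glue G)) A
      κ′ = κ (OutmostGraph.ends (glue G)) A

    -- In `glue-κ` every component count is a defect plus one; three units on the right against one
    -- on the left leave the 2.
    glue-defect : m ℕ.+ defect (glue G) A ≡ 2 ℕ.+ (defect G A₁ ℕ.+ (defect G A₂ ℕ.+ defect G A₃))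
    glue-defect = ℕₚ.suc-injective (begin
      suc (m ℕ.+ defect (glue G) A)      ≡⟨ ℕₚ.+-suc m _ ⟨
      m ℕ.+ suc (defect (glue G) A)      ≡⟨ cong (m ℕ.+_) (suc-defect (glue G) (glue-spanned G G-spanned) A) ⟩
      m ℕ.+ κ′                           ≡⟨ glue-κ A₁ A₂ A₃ S ⟩
      k A₁ ℕ.+ (k A₂ ℕ.+ k A₃)           ≡⟨ cong₂ ℕ._+_ (suc-d A₁) (cong₂ ℕ._+_ (suc-d A₂) (suc-d A₃)) ⟨
      suc d₁ ℕ.+ (suc d₂ ℕ.+ suc d₃)     ≡⟨ ℕ-solve 3 (λ p q r → (con 1 :+ p) :+ ((con 1 :+ q) :+ (con 1 :+ r))
                                                := con 3 :+ (p :+ (q :+ r))) refl d₁ d₂ d₃ ⟩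
      3 ℕ.+ (d₁ ℕ.+ (d₂ ℕ.+ d₃))         ∎)
      where
      open ≡.≡-Reasoning
      open ℕ-Solver using (con; _:+_; _:=_)
      suc-d = suc-defect G G-spanned
      d₁ = defect G A₁
      d₂ = defect G A₂
      d₃ = defect G A₃

    -- By `nullity+#V` the claim reduces to adding up edges and components; the three vertex sets of
    -- the copies cancel against that of the glued graph.
    glue-nullity : m ℕ.+ N′ ≡ ∣ S ∣ ℕ.+ (N A₁ ℕ.+ (N A₂ ℕ.+ N A₃))
    glue-nullity = ℕₚ.+-cancelʳ-≡ (3 ℕ.* #V) _ _ (begin
      m ℕ.+ N′ ℕ.+ 3 ℕ.* #V
        ≡⟨ ℕₚ.+-assoc m N′ _ ⟩
      m ℕ.+ (N′ ℕ.+ 3 ℕ.* #V)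
        ≡⟨ cong (m ℕ.+_) (nullity+#V (glue G) A) ⟩
      m ℕ.+ (∣ A ∣ ℕ.+ κ′)
        ≡⟨ ℕ-solve 3 (λ m a k → m :+ (a :+ k) := a :+ (m :+ k)) refl m (∣ A ∣) κ′ ⟩
      ∣ A ∣ ℕ.+ (m ℕ.+ κ′)
        ≡⟨ cong₂ ℕ._+_ ∣A∣≡ (glue-κ A₁ A₂ A₃ S) ⟩
      ∣ A₁ ∣ ℕ.+ (∣ A₂ ∣ ℕ.+ (∣ A₃ ∣ ℕ.+ ∣ S ∣)) ℕ.+ (k A₁ ℕ.+ (k A₂ ℕ.+ k A₃))
        ≡⟨ ℕ-solve 7 (λ a b c s p q r → a :+ (b :+ (c :+ s)) :+ (p :+ (q :+ r))
             := s :+ ((a :+ p) :+ ((b :+ q) :+ (c :+ r)))) refl (∣ A₁ ∣) (∣ A₂ ∣) (∣ A₃ ∣) (∣ S ∣) (k A₁) (k A₂) (k A₃) ⟩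
      ∣ S ∣ ℕ.+ ((∣ A₁ ∣ ℕ.+ k A₁) ℕ.+ ((∣ A₂ ∣ ℕ.+ k A₂) ℕ.+ (∣ A₃ ∣ ℕ.+ k A₃)))
        ≡⟨ cong (∣ S ∣ ℕ.+_) (cong₂ ℕ._+_ (N+ A₁) (cong₂ ℕ._+_ (N+ A₂) (N+ A₃))) ⟨
      ∣ S ∣ ℕ.+ ((N A₁ ℕ.+ #V) ℕ.+ ((N A₂ ℕ.+ #V) ℕ.+ (N A₃ ℕ.+ #V)))
        ≡⟨ ℕ-solve 5 (λ s p q r v → s :+ ((p :+ v) :+ ((q :+ v) :+ (r :+ v)))
             := s :+ (p :+ (q :+ r)) :+ con 3 :* v) refl (∣ S ∣) (N A₁) (N A₂) (N A₃) #V ⟩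
      ∣ S ∣ ℕ.+ (N A₁ ℕ.+ (N A₂ ℕ.+ N A₃)) ℕ.+ 3 ℕ.* #V ∎)
      where
      open ≡.≡-Reasoning
      open ℕ-Solver using (con; _:+_; _:*_; _:=_)
      N+ = nullity+#V G

      ∣A∣≡ : ∣ A ∣ ≡ ∣ A₁ ∣ ℕ.+ (∣ A₂ ∣ ℕ.+ (∣ A₃ ∣ ℕ.+ ∣ S ∣))
      ∣A∣≡ = trans (∣++∣ A₁ _) (cong (∣ A₁ ∣ ℕ.+_) (trans (∣++∣ A₂ _) (cong (∣ A₂ ∣ ℕ.+_) (∣++∣ A₃ S))))

-- The cubic forms

symmetric : ∀ {c} {C : Set c} → C → C → C → State → C
symmetric h₂ h₁ h₀ TLR   = h₂
symmetric h₂ h₁ h₀ T∣L∣R = h₀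
symmetric h₂ h₁ h₀ _     = h₁

-- A raw semiring has no laws, so the same formulas can be read both in ℚ(x,y) and in the syntax of
-- the ring solver.
module Formulas {c ℓ} (R : RawSemiring c ℓ) where
  open RawSemiring R using (Carrier; _+_; _*_; 0#)
  open RawSemiringDefs R using (_^_)

  infix 9 [_]_

  [_]_ : Bool → Carrier → Carrier
  [ t ] u = if t then u else 0#

  ∑ : ∀ {x} {X : Set x} → List X → (X → Carrier) → Carrier
  ∑ xs f = foldr _+_ 0# (List.map f xs)

  -- Here a = x - 1, b = y - 1, and 1/a is the inverse of a.
  module _ (a 1/a b : Carrier) where
    -- Three copies have Σ (k(Aᵢ) - 1) = k(A) - 1 + m - 2 when the special edges of A merge components
    -- m times; as m = 3 is possible, an inverse of a is needed.
    a^[2-_] : ℕ → Carrier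
    a^[2- 0 ]           = a ^ 2
    a^[2- 1 ]           = a
    a^[2- suc (suc k) ] = 1/a ^ k

    coefficient : ℕ → ℕ → Carrier
    coefficient m s = a^[2- m ] * b ^ (s ∸ m)

    -- A coefficient of the cubic form: the total factor of those sets of special edges that turn
    -- the states s₁, s₂, s₃ of the copies into `c`.
    kernel : State → State → State → State → Carrier
    kernel c s₁ s₂ s₃ = ∑ (allSubsets 3) λ S →
      [ δ (glueState s₁ s₂ s₃ S) c ] coefficient (glueMerges s₁ s₂ s₃ S) ∣ S ∣

    weighted : (State → Carrier) → (State → Carrier) → Carrier
    weighted h f = ∑ states λ s → f s * h s

    -- The cubic form with coefficients `kernel c`, nested so that the sums over the three copies
    -- can be replaced one after the other.
    transfer : State → (State → Carrier) → Carrier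
    transfer c h = weighted h λ s₁ → weighted h λ s₂ → weighted h λ s₃ → kernel c s₁ s₂ s₃

    weightIn : (G : OutmostGraph) → Subset (OutmostGraph.#E G) → Carrier
    weightIn G A = a ^ defect G A * b ^ nullity (OutmostGraph.graph G) A

    stateSum : OutmostGraph → State → Carrier
    stateSum G s = ∑ (allSubsets (OutmostGraph.#E G)) λ A → [ δ (state G A) s ] weightIn G A

-- The operations are bare parameters, and infix notation is introduced by let, so that at the
-- operations of ℚ⟨x,y⟩ this unfolds to syntactically the formulas of the theorem: expressions of
-- this size cannot be compared by unfolding the operations of a fraction field.
Recurrence : ∀ {c ℓ} {C : Set c} (equal : C → C → Set ℓ) (plus times : C → C → C) (power : C → ℕ → C) (multiple : ℕ → C → C)
             (a 1/a b h₂ h₁ h₀ h₂⁺ h₁⁺ h₀⁺ : C) → Set ℓ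
Recurrence equal plus times power multiple a 1/a b h₂ h₁ h₀ h₂⁺ h₁⁺ h₀⁺ =
  let infix 4 _≈_ ; infixl 6 _+_ ; infixl 7 _*_ ; infixr 8 _^_ ; infixr 8 _·_
      _≈_ = equal ; _+_ = plus ; _*_ = times ; _^_ = power ; _·_ = multiple
  in
  (h₂⁺
    ≈ b * h₂ ^ 3
      + 1/a * (6 · h₂ ^ 2 * h₁ + 3 · h₂ * h₁ ^ 2)
      + 3 · h₂ ^ 3 + 6 · h₂ ^ 2 * h₁ + 3 · h₂ * h₁ ^ 2)
  × (h₁⁺
    ≈ b * h₂ ^ 2 * h₁
      + 1/a * (h₂ ^ 2 * h₀ + 7 · h₂ * h₁ ^ 2 + 2 · h₂ * h₁ * h₀ + 4 · h₁ ^ 3 + h₁ ^ 2 * h₀)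
      + 7 · h₂ ^ 2 * h₁ + 2 · h₂ ^ 2 * h₀ + 14 · h₂ * h₁ ^ 2 + 4 · h₂ * h₁ * h₀ + 7 · h₁ ^ 3
      + 2 · h₁ ^ 2 * h₀
      + a * (h₂ ^ 3 + 5 · h₂ ^ 2 * h₁ + h₂ ^ 2 * h₀ + 7 · h₂ * h₁ ^ 2 + 2 · h₂ * h₁ * h₀
             + 3 · h₁ ^ 3 + h₁ ^ 2 * h₀))
  × (h₀⁺
    ≈ b * (3 · h₂ * h₁ ^ 2 + h₁ ^ 3)
      + 1/a * (12 · h₂ * h₁ * h₀ + 3 · h₂ * h₀ ^ 2 + 14 · h₁ ^ 3 + 24 · h₁ ^ 2 * h₀
               + 9 · h₁ * h₀ ^ 2 + h₀ ^ 3)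
      + 3 · h₂ ^ 2 * h₀ + 36 · h₂ * h₁ ^ 2 + 42 · h₂ * h₁ * h₀ + 9 · h₂ * h₀ ^ 2 + 60 · h₁ ^ 3
      + 75 · h₁ ^ 2 * h₀ + 27 · h₁ * h₀ ^ 2 + 3 · h₀ ^ 3
      + a * (12 · h₂ ^ 2 * h₁ + 6 · h₂ ^ 2 * h₀ + 60 · h₂ * h₁ ^ 2 + 48 · h₂ * h₁ * h₀
             + 9 · h₂ * h₀ ^ 2 + 72 · h₁ ^ 3 + 78 · h₁ ^ 2 * h₀ + 27 · h₁ * h₀ ^ 2
             + 3 · h₀ ^ 3)
      + a ^ 2 * (h₂ ^ 3 + 9 · h₂ ^ 2 * h₁ + 3 · h₂ ^ 2 * h₀ + 27 · h₂ * h₁ ^ 2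
                 + 18 · h₂ * h₁ * h₀ + 3 · h₂ * h₀ ^ 2 + 27 · h₁ ^ 3 + 27 · h₁ ^ 2 * h₀
                 + 9 · h₁ * h₀ ^ 2 + h₀ ^ 3))

-- Unlike Recurrence itself, the record is injective in the operations, so instances at different
-- presentations of the same operations are compared operation by operation.
record Satisfied {c ℓ} {C : Set c} (equal : C → C → Set ℓ) (plus times : C → C → C) (power : C → ℕ → C)
                 (multiple : ℕ → C → C) (a 1/a b h₂ h₁ h₀ h₂⁺ h₁⁺ h₀⁺ : C) : Set ℓ where
  constructor satisfied
  field recurrence : Recurrence equal plus times power multiple a 1/a b h₂ h₁ h₀ h₂⁺ h₁⁺ h₀⁺

-- Finite sums

module Summation {c ℓ} (R : CommutativeSemiring c ℓ) where
  open CommutativeSemiring R renaming (refl to ≈-refl; sym to ≈-sym; trans to ≈-trans)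
  open CommutativeSemigroupₚ +-commutativeSemigroup using (interchange)

  open Formulas rawSemiring using ([_]_; ∑) public

  [_]-cong : ∀ t {u w} → u ≈ w → [ t ] u ≈ [ t ] w
  [ true ]-cong  e = e
  [ false ]-cong e = ≈-refl

  [_]-*ʳ³ : ∀ t p u v w → [ t ] (p * u * v * w) ≈ [ t ] p * u * v * w
  [ true ]-*ʳ³  p u v w = ≈-refl
  [ false ]-*ʳ³ p u v w = ≈-sym (≈-trans (*-congʳ (≈-trans (*-congʳ (zeroˡ u)) (zeroˡ v))) (zeroˡ w))

  module _ {x} {X : Set x} where
    ∑-cong : ∀ {f g : X → Carrier} → (∀ x → f x ≈ g x) → ∀ xs → ∑ xs f ≈ ∑ xs g
    ∑-cong e []       = ≈-refl
    ∑-cong e (x ∷ xs) = +-cong (e x) (∑-cong e xs)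

    ∑-0 : ∀ (xs : List X) → ∑ xs (λ _ → 0#) ≈ 0#
    ∑-0 []       = ≈-refl
    ∑-0 (x ∷ xs) = ≈-trans (+-identityˡ _) (∑-0 xs)

    ∑-+ : ∀ (f g : X → Carrier) xs → ∑ xs (λ x → f x + g x) ≈ ∑ xs f + ∑ xs g
    ∑-+ f g []       = ≈-sym (+-identityˡ 0#)
    ∑-+ f g (x ∷ xs) = ≈-trans (+-congˡ (∑-+ f g xs)) (interchange (f x) (g x) _ _)

    ∑-*ʳ : ∀ (f : X → Carrier) u xs → ∑ xs (λ x → f x * u) ≈ ∑ xs f * u
    ∑-*ʳ f u []       = ≈-sym (zeroˡ u)
    ∑-*ʳ f u (x ∷ xs) = ≈-trans (+-congˡ (∑-*ʳ f u xs)) (≈-sym (distribʳ u _ _))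

    ∑-*ʳ³ : ∀ (f : X → Carrier) u v w xs → ∑ xs (λ x → f x * u * v * w) ≈ ∑ xs f * u * v * w
    ∑-*ʳ³ f u v w xs = ≈-trans (∑-*ʳ _ w xs) (*-congʳ (≈-trans (∑-*ʳ _ v xs) (*-congʳ (∑-*ʳ f u xs))))

    ∑-*ˡ : ∀ u (f : X → Carrier) xs → ∑ xs (λ x → u * f x) ≈ u * ∑ xs f
    ∑-*ˡ u f []       = ≈-sym (zeroʳ u)
    ∑-*ˡ u f (x ∷ xs) = ≈-trans (+-congˡ (∑-*ˡ u f xs)) (≈-sym (distribˡ u _ _))

    ∑-++ : ∀ (f : X → Carrier) xs ys → ∑ (xs List.++ ys) f ≈ ∑ xs f + ∑ ys f
    ∑-++ f []       ys = ≈-sym (+-identityˡ _)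
    ∑-++ f (x ∷ xs) ys = ≈-trans (+-congˡ (∑-++ f xs ys)) (≈-sym (+-assoc _ _ _))

  ∑-map : ∀ {x y} {X : Set x} {Y : Set y} (f : Y → Carrier) (g : X → Y) xs → ∑ (List.map g xs) f ≡ ∑ xs (f ∘ g)
  ∑-map f g xs = cong (foldr _+_ 0#) (sym (map-∘ xs))

  ∑-swap : ∀ {x y} {X : Set x} {Y : Set y} (f : X → Y → Carrier) xs ys →
           ∑ xs (λ x → ∑ ys (f x)) ≈ ∑ ys (λ y → ∑ xs (λ x → f x y))
  ∑-swap f []       ys = ≈-sym (∑-0 ys)
  ∑-swap f (x ∷ xs) ys = ≈-trans (+-congˡ (∑-swap f xs ys)) (≈-sym (∑-+ (f x) _ ys))

  -- This splits the edge set of a glued graph into those of the copies and the special edges.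
  -- Subsets are enumerated by branching on the first edge, hence the induction on `m`.
  ∑-allSubsets-++ : ∀ m n (f : Subset (m ℕ.+ n) → Carrier) →
    ∑ (allSubsets (m ℕ.+ n)) f ≈ ∑ (allSubsets m) λ A → ∑ (allSubsets n) λ B → f (A ++ B)
  ∑-allSubsets-++ zero    n f = ≈-sym (+-identityʳ _)
  ∑-allSubsets-++ (suc m) n f = begin
    ∑ (allSubsets (suc m ℕ.+ n)) f
      ≈⟨ ∑-++ f (List.map (outside ∷_) (allSubsets (m ℕ.+ n))) (List.map (inside ∷_) (allSubsets (m ℕ.+ n))) ⟩
    ∑ (List.map (outside ∷_) (allSubsets (m ℕ.+ n))) f + ∑ (List.map (inside ∷_) (allSubsets (m ℕ.+ n))) f
      ≈⟨ +-cong (half outside) (half inside) ⟩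
    ∑ (List.map (outside ∷_) (allSubsets m)) g + ∑ (List.map (inside ∷_) (allSubsets m)) g
      ≈⟨ ∑-++ g (List.map (outside ∷_) (allSubsets m)) _ ⟨
    ∑ (allSubsets (suc m)) g ∎
    where
    open SetoidReasoning (CommutativeSemiring.setoid R)
    g : Subset (suc m) → Carrier
    g A = ∑ (allSubsets n) λ B → f (A ++ B)

    half : ∀ s → ∑ (List.map (s ∷_) (allSubsets (m ℕ.+ n))) f ≈ ∑ (List.map (s ∷_) (allSubsets m)) g
    half s = begin
      ∑ (List.map (s ∷_) (allSubsets (m ℕ.+ n))) f    ≡⟨ ∑-map f (s ∷_) (allSubsets (m ℕ.+ n)) ⟩
      ∑ (allSubsets (m ℕ.+ n)) (f ∘ (s ∷_))           ≈⟨ ∑-allSubsets-++ m n (f ∘ (s ∷_)) ⟩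
      ∑ (allSubsets m) (g ∘ (s ∷_))                   ≡⟨ ∑-map g (s ∷_) (allSubsets m) ⟨
      ∑ (List.map (s ∷_) (allSubsets m)) g            ∎

  ∑-δ : ∀ (F : State → Carrier) t w → ∑ states (λ s → F s * [ δ t s ] w) ≈ F t * w
  ∑-δ F t w = pick t
    where
    skip : ∀ {p q} → p * 0# + q ≈ q
    skip {p} = ≈-trans (+-congʳ (zeroʳ p)) (+-identityˡ _)

    last : ∀ {p q} → q ≈ 0# → p + q ≈ p
    last e = ≈-trans (+-congˡ e) (+-identityʳ _)

    pick : ∀ t → ∑ states (λ s → F s * [ δ t s ] w) ≈ F t * w
    pick TLR   = last (≈-trans skip (≈-trans skip (≈-trans skip skip)))
    pick T∣LR  = ≈-trans skip (last (≈-trans skip (≈-trans skip skip)))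
    pick TL∣R  = ≈-trans skip (≈-trans skip (last (≈-trans skip skip)))
    pick TR∣L  = ≈-trans skip (≈-trans skip (≈-trans skip (last skip)))
    pick T∣L∣R = ≈-trans skip (≈-trans skip (≈-trans skip (≈-trans skip (+-identityʳ _))))

  -- Grouping by state: `F (φ x)` is spread by `∑-δ` over all states, of which only `φ x`
  -- contributes, and the two sums are exchanged.
  ∑-fibres : ∀ {x} {X : Set x} (F : State → Carrier) (φ : X → State) (w : X → Carrier) xs →
             ∑ xs (λ x → F (φ x) * w x) ≈ ∑ states (λ s → F s * ∑ xs (λ x → [ δ (φ x) s ] w x))
  ∑-fibres F φ w xs = begin
    ∑ xs (λ x → F (φ x) * w x)                                 ≈⟨ ∑-cong (λ x → ∑-δ F (φ x) (w x)) xs ⟨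
    ∑ xs (λ x → ∑ states (λ s → F s * [ δ (φ x) s ] w x))      ≈⟨ ∑-swap (λ x s → F s * [ δ (φ x) s ] w x) xs states ⟩
    ∑ states (λ s → ∑ xs (λ x → F s * [ δ (φ x) s ] w x))      ≈⟨ ∑-cong (λ s → ∑-*ˡ (F s) (λ x → [ δ (φ x) s ] w x) xs) states ⟩
    ∑ states (λ s → F s * ∑ xs (λ x → [ δ (φ x) s ] w x))      ∎
    where open SetoidReasoning (CommutativeSemiring.setoid R)

-- State sums of a glued graph

module Transfer {c ℓ} (R : CommutativeSemiring c ℓ) where
  open CommutativeSemiring R renaming (refl to ≈-refl; sym to ≈-sym; trans to ≈-trans)
  open Summation R
  open Exp semiring using (_^_; ^-homo-*; ^-congʳ)
  open SetoidReasoning (CommutativeSemiring.setoid R)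
  open Mult semiring using () renaming (_×_ to infixr 8 _·_)
  open Solver R using (solve; _:=_; _:*_; _:+_; con) renaming (_:×_ to infixr 9 _:·_)

  module Formula = Formulas rawSemiring

  module _ (a 1/a b : Carrier) where
    private
      a^[2-_] = Formula.a^[2-_] a 1/a b
      coefficient = Formula.coefficient a 1/a b
      kernel = Formula.kernel a 1/a b
      weighted = Formula.weighted a 1/a b
      transfer = Formula.transfer a 1/a b
      weightIn = Formula.weightIn a 1/a b
      stateSum = Formula.stateSum a 1/a b

    weighted-cong : ∀ {h h′} → (∀ s → h s ≈ h′ s) → ∀ f f′ → (∀ s → f s ≈ f′ s) → weighted h f ≈ weighted h′ f′
    weighted-cong {h} {h′} h≈ f f′ f≈ =
      ∑-cong {f = λ s → f s * h s} {g = λ s → f′ s * h′ s} (λ s → *-cong (f≈ s) (h≈ s)) states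

    transfer-cong : ∀ c {h h′} → (∀ s → h s ≈ h′ s) → transfer c h ≈ transfer c h′
    transfer-cong c {h} {h′} h≈ =
      weighted-cong h≈ (λ s₁ → weighted h (λ s₂ → weighted h (kernel c s₁ s₂)))
                       (λ s₁ → weighted h′ (λ s₂ → weighted h′ (kernel c s₁ s₂))) λ s₁ →
      weighted-cong h≈ (λ s₂ → weighted h (kernel c s₁ s₂)) (λ s₂ → weighted h′ (kernel c s₁ s₂)) λ s₂ →
      weighted-cong h≈ (kernel c s₁ s₂) (kernel c s₁ s₂) λ s₃ → ≈-refl

    module _ (a*1/a≈1 : a * 1/a ≈ 1#) where
      cancel-^ : ∀ k e → 1/a ^ k * a ^ (k ℕ.+ e) ≈ a ^ e
      cancel-^ zero    e = *-identityˡ _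
      cancel-^ (suc k) e = begin
        (1/a * 1/a ^ k) * (a * a ^ (k ℕ.+ e))
          ≈⟨ solve 4 (λ a i p q → (i :* p) :* (a :* q) := (a :* i) :* (p :* q)) ≈-refl a 1/a (1/a ^ k) (a ^ (k ℕ.+ e)) ⟩
        (a * 1/a) * (1/a ^ k * a ^ (k ℕ.+ e))    ≈⟨ *-cong a*1/a≈1 (cancel-^ k e) ⟩
        1# * a ^ e                               ≈⟨ *-identityˡ _ ⟩
        a ^ e                                    ∎

      -- This turns `glue-defect` into a product. For m = k + 2 the hypothesis reads e′ = k + e, and
      -- the k surplus factors are cancelled by `1/a ^ k`.
      a^-split : ∀ m {e e′} → m ℕ.+ e ≡ 2 ℕ.+ e′ → a ^ e ≈ a^[2- m ] * a ^ e′
      a^-split 0             {e′ = e′} refl = ^-homo-* a 2 e′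
      a^-split 1                       refl = ≈-refl
      a^-split (suc (suc k)) {e}       refl = ≈-sym (cancel-^ k e)

      b^-split : ∀ {m s e e′} → m ≤ s → m ℕ.+ e ≡ s ℕ.+ e′ → b ^ e ≈ b ^ (s ∸ m) * b ^ e′
      b^-split {m} {s} {e} {e′} m≤s eq = ≈-trans (^-congʳ b e≡) (^-homo-* b (s ∸ m) e′)
        where
        e≡ : e ≡ (s ∸ m) ℕ.+ e′
        e≡ = ℕₚ.+-cancelˡ-≡ m _ _ (trans eq (trans (cong (ℕ._+ e′) (sym (ℕₚ.m+[n∸m]≡n m≤s))) (ℕₚ.+-assoc m _ _)))

      module _ {G : OutmostGraph} (G-spanned : Spanned G) where
        open OutmostGraph G using (#E; graph)
        open Glue G using (glued; glue-state)

        private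
          st = state G
          w  = weightIn G

        -- The exponents come from `glue-defect` and `glue-nullity`. The weight of the innermost
        -- copy stands first, so that the outer ones can be pulled out of its sum on the right.
        weightIn-glued : ∀ A₁ A₂ A₃ S → weightIn (glue G) (glued A₁ A₂ A₃ S) ≈
          coefficient (glueMerges (st A₁) (st A₂) (st A₃) S) ∣ S ∣ * w A₃ * w A₂ * w A₁
        weightIn-glued A₁ A₂ A₃ S = begin
          weightIn (glue G) (glued A₁ A₂ A₃ S)
            ≈⟨ *-cong (≈-trans (a^-split m (glue-defect G-spanned A₁ A₂ A₃ S)) (*-congˡ (^-3 a d)))
                      (≈-trans (b^-split (merges≤ specials S _) (glue-nullity G-spanned A₁ A₂ A₃ S)) (*-congˡ (^-3 b n))) ⟩
          (_ * (a ^ d A₁ * (a ^ d A₂ * a ^ d A₃))) * (_ * (b ^ n A₁ * (b ^ n A₂ * b ^ n A₃)))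
            ≈⟨ solve 8 (λ p q a₁ a₂ a₃ b₁ b₂ b₃ → (p :* (a₁ :* (a₂ :* a₃))) :* (q :* (b₁ :* (b₂ :* b₃)))
                 := (p :* q) :* (a₃ :* b₃) :* (a₂ :* b₂) :* (a₁ :* b₁)) ≈-refl
                 a^[2- m ] (b ^ (∣ S ∣ ∸ m))
                 (a ^ d A₁) (a ^ d A₂) (a ^ d A₃) (b ^ n A₁) (b ^ n A₂) (b ^ n A₃) ⟩
          coefficient m ∣ S ∣ * w A₃ * w A₂ * w A₁ ∎
          where
          m = glueMerges (st A₁) (st A₂) (st A₃) S
          d = defect G
          n = nullity graph
          ^-3 : ∀ u (f : Subset #E → ℕ) → u ^ (f A₁ ℕ.+ (f A₂ ℕ.+ f A₃)) ≈ u ^ f A₁ * (u ^ f A₂ * u ^ f A₃)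
          ^-3 u f = ≈-trans (^-homo-* u (f A₁) _) (*-congˡ (^-homo-* u (f A₂) (f A₃)))

        byState : ∀ (F : State → Carrier) → ∑ (allSubsets #E) (λ A → F (st A) * w A) ≈ weighted (stateSum G) F
        byState F = ∑-fibres F st w (allSubsets #E)

        -- Summing over the special edges gives the kernel, which sees each copy only through its
        -- state. From the third copy to the first, `byState` then replaces the sum over subgraphs
        -- by a sum over states.
        stateSum-glue : ∀ c → stateSum (glue G) c ≈ transfer c (stateSum G)
        stateSum-glue c = begin
          stateSum (glue G) c
            ≈⟨ ∑-allSubsets-++ #E _ f ⟩
          (∑ subsets λ A₁ → ∑ (allSubsets (#E ℕ.+ (#E ℕ.+ 3))) λ B → f (A₁ ++ B))
            ≈⟨ ∑-cong (λ A₁ → ≈-trans (∑-allSubsets-++ #E _ _) (∑-cong (λ A₂ → ∑-allSubsets-++ #E 3 _) subsets)) subsets ⟩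
          (∑ subsets λ A₁ → ∑ subsets λ A₂ → ∑ subsets λ A₃ → ∑ (allSubsets 3) λ S → f (glued A₁ A₂ A₃ S))
            ≈⟨ ∑-cong (λ A₁ → ∑-cong (λ A₂ → ∑-cong (λ A₃ → overSpecials A₁ A₂ A₃) subsets) subsets) subsets ⟩
          (∑ subsets λ A₁ → ∑ subsets λ A₂ → ∑ subsets λ A₃ → kernel c (st A₁) (st A₂) (st A₃) * w A₃ * w A₂ * w A₁)
            ≈⟨ ∑-cong (λ A₁ → ∑-cong (λ A₂ → ≈-trans (∑-*ʳ _ (w A₁) subsets) (*-congʳ (∑-*ʳ _ (w A₂) subsets))) subsets) subsets ⟩
          (∑ subsets λ A₁ → ∑ subsets λ A₂ → (∑ subsets λ A₃ → kernel c (st A₁) (st A₂) (st A₃) * w A₃) * w A₂ * w A₁)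
            ≈⟨ ∑-cong (λ A₁ → ∑-cong (λ A₂ → *-congʳ (*-congʳ (byState (kernel c (st A₁) (st A₂))))) subsets) subsets ⟩
          (∑ subsets λ A₁ → ∑ subsets λ A₂ → K₂ (st A₁) (st A₂) * w A₂ * w A₁)
            ≈⟨ ∑-cong (λ A₁ → ≈-trans (∑-*ʳ _ (w A₁) subsets) (*-congʳ (byState (K₂ (st A₁))))) subsets ⟩
          (∑ subsets λ A₁ → K₁ (st A₁) * w A₁)
            ≈⟨ byState K₁ ⟩
          transfer c (stateSum G) ∎
          where
          subsets = allSubsets #E

          f : Subset (OutmostGraph.#E (glue G)) → Carrier
          f A = [ δ (state (glue G) A) c ] weightIn (glue G) A

          K₂ : State → State → Carrier
          K₂ s₁ s₂ = weighted (stateSum G) (kernel c s₁ s₂)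

          K₁ : State → Carrier
          K₁ s₁ = weighted (stateSum G) (K₂ s₁)

          overSpecials : ∀ A₁ A₂ A₃ → ∑ (allSubsets 3) (λ S → f (glued A₁ A₂ A₃ S)) ≈
                         kernel c (st A₁) (st A₂) (st A₃) * w A₃ * w A₂ * w A₁
          overSpecials A₁ A₂ A₃ = ≈-trans (∑-cong term (allSubsets 3)) (∑-*ʳ³ k (w A₃) (w A₂) (w A₁) (allSubsets 3))
            where
            m : Subset 3 → ℕ
            m = glueMerges (st A₁) (st A₂) (st A₃)

            t : Subset 3 → Bool
            t S = δ (glueState (st A₁) (st A₂) (st A₃) S) c

            k : Subset 3 → Carrier
            k S = [ t S ] coefficient (m S) ∣ S ∣

            term : ∀ S → f (glued A₁ A₂ A₃ S) ≈ k S * w A₃ * w A₂ * w A₁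
            term S = begin
              f (glued A₁ A₂ A₃ S)
                ≡⟨ cong (λ s → [ δ s c ] weightIn (glue G) (glued A₁ A₂ A₃ S)) (glue-state A₁ A₂ A₃ S) ⟩
              [ t S ] weightIn (glue G) (glued A₁ A₂ A₃ S)
                ≈⟨ [ t S ]-cong (weightIn-glued A₁ A₂ A₃ S) ⟩
              [ t S ] (coefficient (m S) ∣ S ∣ * w A₃ * w A₂ * w A₁)
                ≈⟨ [ t S ]-*ʳ³ (coefficient (m S) ∣ S ∣) (w A₃) (w A₂) (w A₁) ⟩
              k S * w A₃ * w A₂ * w A₁ ∎

  -- Symbolic evaluation of the cubic forms

  module _ where
    open Solver R using (Polynomial; var; prove; _:^_; ⟦_⟧; ⟦_⟧↓)

    polynomials : ℕ → RawSemiring _ _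
    polynomials n = record
      { Carrier = Polynomial n ; _≈_ = _≡_ ; _+_ = _:+_ ; _*_ = _:*_ ; 0# = con 0 ; 1# = con 1 }

    module Symbolic = Formulas (polynomials 6)
    module Symbolic₃ = Formulas (polynomials 3)

    -- As opposed to equality of values, this determines p and q, so the symbolic recurrence need
    -- not be spelled out a second time.
    record _≋_ (p q : Polynomial 6) : Set (c Level.⊔ ℓ) where
      constructor sameNormalForm
      field onNormalForms : ∀ ρ → ⟦ p ⟧↓ ρ ≈ ⟦ q ⟧↓ ρ

    evaluate : ∀ {p q} → p ≋ q → ∀ ρ → ⟦ p ⟧ ρ ≈ ⟦ q ⟧ ρ
    evaluate {p} {q} e ρ = prove ρ p q (_≋_.onNormalForms e ρ)

    symbolicTransfer : State → Polynomial 6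
    symbolicTransfer c = Symbolic.transfer (var 0F) (var 1F) (var 2F) c
      (symmetric (var 3F) (var 4F) (var 5F))

    -- All combinations of states and special edges are evaluated by normalisation. The variables
    -- stand for a, `1/a`, b, h₂, h₁, h₀, with `1/a` independent of a.
    symbolic-recurrence : Recurrence _≋_ _:+_ _:*_ _:^_ _:·_ (var 0F) (var 1F) (var 2F) (var 3F) (var 4F) (var 5F)
      (symbolicTransfer TLR) (symbolicTransfer T∣LR) (symbolicTransfer T∣L∣R)
    symbolic-recurrence =
      sameNormalForm (λ ρ → ≈-refl) , sameNormalForm (λ ρ → ≈-refl) , sameNormalForm (λ ρ → ≈-refl)

    -- Both sides have the same normal form. This and `transfer-TR∣L` provide the induction step of
    -- `h-symmetric`, the two identities for the triangle its base.
    transfer-TL∣R : ∀ a 1/a b h₂ h₁ h₀ →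
      Formula.transfer a 1/a b TL∣R (symmetric h₂ h₁ h₀) ≈
      Formula.transfer a 1/a b T∣LR (symmetric h₂ h₁ h₀)
    transfer-TL∣R = solve 6 (λ a 1/a b h₂ h₁ h₀ →
      Symbolic.transfer a 1/a b TL∣R (symmetric h₂ h₁ h₀) :=
      Symbolic.transfer a 1/a b T∣LR (symmetric h₂ h₁ h₀)) ≈-refl

    transfer-TR∣L : ∀ a 1/a b h₂ h₁ h₀ →
      Formula.transfer a 1/a b TR∣L (symmetric h₂ h₁ h₀) ≈
      Formula.transfer a 1/a b T∣LR (symmetric h₂ h₁ h₀)
    transfer-TR∣L = solve 6 (λ a 1/a b h₂ h₁ h₀ →
      Symbolic.transfer a 1/a b TR∣L (symmetric h₂ h₁ h₀) :=
      Symbolic.transfer a 1/a b T∣LR (symmetric h₂ h₁ h₀)) ≈-refl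

    triangle-TL∣R : ∀ a 1/a b → Formula.stateSum a 1/a b triangle TL∣R ≈ Formula.stateSum a 1/a b triangle T∣LR
    triangle-TL∣R = solve 3 (λ a 1/a b → Symbolic₃.stateSum a 1/a b triangle TL∣R := Symbolic₃.stateSum a 1/a b triangle T∣LR) ≈-refl

    triangle-TR∣L : ∀ a 1/a b → Formula.stateSum a 1/a b triangle TR∣L ≈ Formula.stateSum a 1/a b triangle T∣LR
    triangle-TR∣L = solve 3 (λ a 1/a b → Symbolic₃.stateSum a 1/a b triangle TR∣L := Symbolic₃.stateSum a 1/a b triangle T∣LR) ≈-refl

  ∑-symmetric : ∀ h₂ h₁ h₀ → ∑ states (symmetric h₂ h₁ h₀) ≈ h₂ + 3 · h₁ + h₀
  ∑-symmetric = solve 3 (λ p q r → p :+ (q :+ (q :+ (q :+ (r :+ con 0)))) := p :+ 3 :· q :+ r) ≈-refl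

  -- Symmetry and recurrence of the state sums

  module _ (a 1/a b : Carrier) (a*1/a≈1 : a * 1/a ≈ 1#) where
    private
      transfer = Formula.transfer a 1/a b

    h : (n : ℕ) → .{{_ : NonZero n}} → State → Carrier
    h n = Formula.stateSum a 1/a b (Sigma n)

    symmetricAt : (n : ℕ) → .{{_ : NonZero n}} → State → Carrier
    symmetricAt n = symmetric (h n TLR) (h n T∣LR) (h n T∣L∣R)

    h-suc : ∀ n .{{_ : NonZero n}} {h′} → (∀ s → h n s ≈ h′ s) → ∀ c → h (suc n) c ≈ transfer c h′
    -- Exposing the successor lets `Sigma (suc n)` reduce to `glue (Sigma n)`.
    h-suc n@(suc _) h≈ c = ≈-trans (stateSum-glue a 1/a b a*1/a≈1 (sigma-spanned n) c) (transfer-cong a 1/a b c h≈)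

    -- The transfer preserves the symmetry, so no automorphisms of the graphs are needed.
    h-symmetric : ∀ n .{{_ : NonZero n}} s → h n s ≈ symmetricAt n s
    h-symmetric n TLR             = ≈-refl
    h-symmetric n T∣LR            = ≈-refl
    h-symmetric n T∣L∣R           = ≈-refl
    h-symmetric 1 TL∣R            = triangle-TL∣R a 1/a b
    h-symmetric 1 TR∣L            = triangle-TR∣L a 1/a b
    h-symmetric (suc n@(suc _)) TL∣R = begin
      h (suc n) TL∣R                    ≈⟨ h-suc n (h-symmetric n) TL∣R ⟩
      transfer TL∣R (symmetricAt n)     ≈⟨ transfer-TL∣R a 1/a b (h n TLR) (h n T∣LR) (h n T∣L∣R) ⟩
      transfer T∣LR (symmetricAt n)     ≈⟨ h-suc n (h-symmetric n) T∣LR ⟨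
      h (suc n) T∣LR                    ∎
    h-symmetric (suc n@(suc _)) TR∣L = begin
      h (suc n) TR∣L                    ≈⟨ h-suc n (h-symmetric n) TR∣L ⟩
      transfer TR∣L (symmetricAt n)     ≈⟨ transfer-TR∣L a 1/a b (h n TLR) (h n T∣LR) (h n T∣L∣R) ⟩
      transfer T∣LR (symmetricAt n)     ≈⟨ h-suc n (h-symmetric n) T∣LR ⟨
      h (suc n) T∣LR                    ∎

    h-total : ∀ n .{{_ : NonZero n}} → ∑ (allSubsets (OutmostGraph.#E (Sigma n))) (Formula.weightIn a 1/a b (Sigma n)) ≈
              h n TLR + 3 · h n T∣LR + h n T∣L∣R
    h-total n = begin
      ∑ subsets w                       ≈⟨ ∑-cong (λ A → *-identityˡ (w A)) subsets ⟨
      -- The constant function 1 on states makes `∑-fibres` a mere partition of the subgraphs by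
      -- state.
      ∑ subsets (λ A → 1# * w A)        ≈⟨ ∑-fibres (λ _ → 1#) (state (Sigma n)) w subsets ⟩
      ∑ states (λ s → 1# * h n s)       ≈⟨ ∑-cong {f = λ s → 1# * h n s} {g = symmetricAt n}
                                             (λ s → ≈-trans (*-identityˡ (h n s)) (h-symmetric n s)) states ⟩
      ∑ states (symmetricAt n)          ≈⟨ ∑-symmetric (h n TLR) (h n T∣LR) (h n T∣L∣R) ⟩
      h n TLR + 3 · h n T∣LR + h n T∣L∣R ∎
      where
      subsets = allSubsets (OutmostGraph.#E (Sigma n))
      w = Formula.weightIn a 1/a b (Sigma n)

    module _ (n : ℕ) .{{_ : NonZero n}} {h₂ h₁ h₀ : Carrier}
             (h₂≈ : h₂ ≈ h n TLR) (h₁≈ : h₁ ≈ h n T∣LR) (h₀≈ : h₀ ≈ h n T∣L∣R) where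
      h≈symmetric : ∀ s → h n s ≈ symmetric h₂ h₁ h₀ s
      h≈symmetric TLR   = ≈-sym h₂≈
      h≈symmetric T∣LR  = ≈-sym h₁≈
      h≈symmetric TL∣R  = ≈-trans (h-symmetric n TL∣R) (≈-sym h₁≈)
      h≈symmetric TR∣L  = ≈-trans (h-symmetric n TR∣L) (≈-sym h₁≈)
      h≈symmetric T∣L∣R = ≈-sym h₀≈

      -- The values need only agree with the state sums up to `_≈_`, so the fractions of `H₂`, `H₁`,
      -- `H₀` can be inserted directly.
      stateSum-recurrence : ∀ {h₂⁺ h₁⁺ h₀⁺} → h₂⁺ ≈ h (suc n) TLR → h₁⁺ ≈ h (suc n) T∣LR → h₀⁺ ≈ h (suc n) T∣L∣R →
                            Satisfied _≈_ _+_ _*_ _^_ _·_ a 1/a b h₂ h₁ h₀ h₂⁺ h₁⁺ h₀⁺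
      stateSum-recurrence e₂ e₁ e₀ with f₂ , f₁ , f₀ ← symbolic-recurrence = satisfied
        ( ≈-trans (via e₂) (evaluate f₂ ρ)
        , ≈-trans (via e₁) (evaluate f₁ ρ)
        , ≈-trans (via e₀) (evaluate f₀ ρ) )
        where
        ρ = a ∷ 1/a ∷ b ∷ h₂ ∷ h₁ ∷ h₀ ∷ []

        via : ∀ {h⁺ c} → h⁺ ≈ h (suc n) c → h⁺ ≈ transfer c (symmetric h₂ h₁ h₀)
        via {c = c} e = ≈-trans e (h-suc n h≈symmetric c)

-- From a domain to its fractions

module FractionMap {c ℓ} (D : IntegralDomain c ℓ) where
  private
    module D = IntegralDomain D
    module S = Solver D.commutativeSemiring
  open Fractions D using (fraction; mkFraction; fractionField; mk≈; cross)
  open CommutativeRing fractionField renaming (refl to ≈-refl; sym to ≈-sym; trans to ≈-trans)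
  open Exp D.semiring using () renaming (_^_ to _^ᴰ_)
  open Mult D.semiring using () renaming (_×_ to infixr 8 _·ᴰ_)
  open Exp semiring using (_^_; ^-congˡ)
  open Mult semiring using (×-congʳ) renaming (_×_ to infixr 8 _·_)
  open Summation commutativeSemiring using ([_]_; ∑)
  open S using (_:=_; _:+_; _:*_; con)

  -- State sums live in the fraction field; this brings the decomposition of `H` back to
  -- polynomials.
  fraction-injective : ∀ {p q} → fraction p ≈ fraction q → p D.≈ q
  fraction-injective {p} {q} e = D.trans (D.sym (D.*-identityʳ p)) (D.trans (cross e) (D.*-identityʳ q))

  fraction-+ : ∀ p q → fraction (p D.+ q) ≈ fraction p + fraction q
  fraction-+ p q = mk≈ (S.solve 2 (λ p q → (p :+ q) :* (con 1 :* con 1) := (p :* con 1 :+ q :* con 1) :* con 1) D.refl p q)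

  fraction-- : ∀ p q → fraction (p D.- q) ≈ fraction p - fraction q
  fraction-- p q = fraction-+ p (D.- q)

  fraction-* : ∀ p q → fraction (p D.* q) ≈ fraction p * fraction q
  fraction-* p q = mk≈ (S.solve 2 (λ p q → (p :* q) :* (con 1 :* con 1) := (p :* q) :* con 1) D.refl p q)

  fraction-^ : ∀ p n → fraction (p ^ᴰ n) ≈ fraction p ^ n
  fraction-^ p zero    = ≈-refl
  fraction-^ p (suc n) = ≈-trans (fraction-* p (p ^ᴰ n)) (*-congˡ {fraction p} (fraction-^ p n))

  fraction-· : ∀ n p → fraction (n ·ᴰ p) ≈ n · fraction p
  fraction-· zero    p = ≈-refl
  fraction-· (suc n) p = ≈-trans (fraction-+ p (n ·ᴰ p)) (+-congˡ {fraction p} (fraction-· n p))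

  *-inverse : ∀ {p q} (p≉0 : ¬ p D.≈ D.0#) → fraction p ≈ q → q * mkFraction D.1# p p≉0 ≈ 1#
  *-inverse {p} p≉0 e = ≈-trans (*-congʳ {mkFraction D.1# p p≉0} (≈-sym e))
    (mk≈ (S.solve 1 (λ p → (p :* con 1) :* con 1 := con 1 :* (con 1 :* p)) D.refl p))

  fraction-^*^ : ∀ {p p′ q q′} → fraction p ≈ p′ → fraction q ≈ q′ → ∀ m n →
                 fraction (p ^ᴰ m D.* q ^ᴰ n) ≈ p′ ^ m * q′ ^ n
  fraction-^*^ {p} {p′} {q} {q′} e f m n = ≈-trans (fraction-* (p ^ᴰ m) (q ^ᴰ n))
    (*-cong (≈-trans (fraction-^ p m) (^-congˡ m e)) (≈-trans (fraction-^ q n) (^-congˡ n f)))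

  module _ {x} {X : Set x} {f : X → D.Carrier} {g : X → Carrier} (f≈g : ∀ x → fraction (f x) ≈ g x) where
    fraction-∑ : ∀ xs → fraction (foldr D._+_ D.0# (List.map f xs)) ≈ ∑ xs g
    fraction-∑ []       = ≈-refl
    fraction-∑ (x ∷ xs) = ≈-trans (fraction-+ (f x) _) (+-cong (f≈g x) (fraction-∑ xs))

    fraction-∑-filter : ∀ {p} {P : X → Set p} (P? : ∀ x → Dec (P x)) {t : X → Bool} → (∀ x → does (P? x) ≡ t x) → ∀ xs →
      fraction (foldr D._+_ D.0# (List.map f (List.filter P? xs))) ≈ ∑ xs (λ x → [ t x ] g x)
    fraction-∑-filter P? P?≡t []       = ≈-refl
    -- After the rewriting, the filter and the indicator branch on the same Boolean; a discarded
    -- entry becomes a summand 0.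
    fraction-∑-filter P? {t} P?≡t (x ∷ xs) rewrite sym (P?≡t x) with does (P? x)
    ... | true  = ≈-trans (fraction-+ (f x) _) (+-cong (f≈g x) (fraction-∑-filter P? P?≡t xs))
    ... | false = ≈-trans (fraction-∑-filter P? P?≡t xs) (≈-sym (+-identityˡ _))

  fraction-split : ∀ {p q r s q′ r′ s′} → fraction p ≈ q′ + 3 · r′ + s′ →
                   fraction q ≈ q′ → fraction r ≈ r′ → fraction s ≈ s′ → p D.≈ q D.+ 3 ·ᴰ r D.+ s
  fraction-split {p} {q} {r} {s} {q′} {r′} {s′} p≈ q≈ r≈ s≈ = fraction-injective (begin
    fraction p                                        ≈⟨ p≈ ⟩
    q′ + 3 · r′ + s′                                  ≈⟨ +-cong (+-cong q≈ (≈-trans (fraction-· 3 r) (×-congʳ 3 r≈))) s≈ ⟨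
    fraction q + fraction (3 ·ᴰ r) + fraction s       ≈⟨ +-congʳ {fraction s} (fraction-+ q (3 ·ᴰ r)) ⟨
    fraction (q D.+ 3 ·ᴰ r) + fraction s              ≈⟨ fraction-+ (q D.+ 3 ·ᴰ r) s ⟨
    fraction (q D.+ 3 ·ᴰ r D.+ s)                     ∎)
    where open SetoidReasoning (CommutativeRing.setoid fractionField)

-- The polynomials of the Hanoi graphs

open ℚ⟨x,y⟩ using (fraction)
open FractionMap ℤ[x,y]-domain
open Transfer ℚ⟨x,y⟩.commutativeSemiring

a b : ℚ⟨x,y⟩.Carrier
a = ℚ⟨x,y⟩.x ℚ⟨x,y⟩.- ℚ⟨x,y⟩.1#
b = ℚ⟨x,y⟩.y ℚ⟨x,y⟩.- ℚ⟨x,y⟩.1#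

a*1/a≈1 : a ℚ⟨x,y⟩.* ℚ⟨x,y⟩.1/[x-1] ℚ⟨x,y⟩.≈ ℚ⟨x,y⟩.1#
a*1/a≈1 = *-inverse ℤ[x,y].x-1≉0 (fraction-- ℤ[x,y].x ℤ[x,y].1#)

fraction-weight : ∀ G A → fraction (weight (OutmostGraph.graph G) A) ℚ⟨x,y⟩.≈ Formula.weightIn a ℚ⟨x,y⟩.1/[x-1] b G A
fraction-weight G A = fraction-^*^ (fraction-- ℤ[x,y].x ℤ[x,y].1#) (fraction-- ℤ[x,y].y ℤ[x,y].1#)
  (defect G A) (nullity (OutmostGraph.graph G) A)

module _ (n : ℕ) .{{_ : NonZero n}} where
  private
    G = Sigma n
    open OutmostGraph G
    hₙ = h a ℚ⟨x,y⟩.1/[x-1] b a*1/a≈1 n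

    tl lr tr : Subset #E → Bool
    tl A = does (Connectivity.connected? ends A top left)
    lr A = does (Connectivity.connected? ends A left right)
    tr A = does (Connectivity.connected? ends A top right)

  fraction-H₂ : fraction (H₂ n) ℚ⟨x,y⟩.≈ hₙ TLR
  fraction-H₂ = fraction-∑-filter (fraction-weight G) (allTogether? G)
    (λ A → δ-TLR (tl A) (lr A) (tr A)) (allSubsets #E)

  fraction-H₁ : fraction (H₁ n) ℚ⟨x,y⟩.≈ hₙ T∣LR
  fraction-H₁ = fraction-∑-filter (fraction-weight G) (leftRightOnly? G)
    (λ A → δ-T∣LR (tl A) (lr A) (tr A)) (allSubsets #E)

  fraction-H₀ : fraction (H₀ n) ℚ⟨x,y⟩.≈ hₙ T∣L∣R
  fraction-H₀ = fraction-∑-filter (fraction-weight G) (allSeparate? G)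
    (λ A → δ-T∣L∣R (tl A) (lr A) (tr A)) (allSubsets #E)

  fraction-H : fraction (H n) ℚ⟨x,y⟩.≈ hₙ TLR ℚ⟨x,y⟩.+ 3 ℚ⟨x,y⟩.· hₙ T∣LR ℚ⟨x,y⟩.+ hₙ T∣L∣R
  fraction-H = ℚ⟨x,y⟩.trans (fraction-∑ (fraction-weight G) (allSubsets #E)) (h-total a ℚ⟨x,y⟩.1/[x-1] b a*1/a≈1 n)

  decomposition : H n ℤ[x,y].≈ H₂ n ℤ[x,y].+ 3 ℤ[x,y].· H₁ n ℤ[x,y].+ H₀ n
  decomposition = fraction-split fraction-H fraction-H₂ fraction-H₁ fraction-H₀

module _ (n : ℕ) .{{_ : NonZero n}} where
  open ℚ⟨x,y⟩

  recurrence-H : Satisfied _≈_ _+_ _*_ _^_ _·_ (x - 1#) 1/[x-1] (y - 1#)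
                   (fraction (H₂ n)) (fraction (H₁ n)) (fraction (H₀ n))
                   (fraction (H₂ (suc n))) (fraction (H₁ (suc n))) (fraction (H₀ (suc n)))
  recurrence-H = stateSum-recurrence (x - 1#) 1/[x-1] (y - 1#) a*1/a≈1 n
    (fraction-H₂ n) (fraction-H₁ n) (fraction-H₀ n) (fraction-H₂ (suc n)) (fraction-H₁ (suc n)) (fraction-H₀ (suc n))

-- Vanishing of a polynomial is decidable, so the initial values are settled by evaluating sums over
-- the eight spanning subgraphs of the triangle.
decide-≈ : ∀ p q {_ : True (ℤ[x,y].≈0? (p ℤ[x,y].- q))} → p ℤ[x,y].≈ q
decide-≈ p q {p-q≈0} = Groupₚ.x∙y⁻¹≈ε⇒x≈y ℤ[x,y].+-group p q (toWitness p-q≈0)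

theorem4p3 :
  (let open ℤ[x,y] in
    ((n : ℕ) → .{{_ : NonZero n}} → H n ≈ H₂ n + 3 · H₁ n + H₀ n)
    × H₂ 1 ≈ y + 2 · 1#
    × H₁ 1 ≈ x - 1#
    × H₀ 1 ≈ (x - 1#) ^ 2)
  × ((n : ℕ) → .{{_ : NonZero n}} →
    let open ℚ⟨x,y⟩
        h₂ = fraction (H₂ n)
        h₁ = fraction (H₁ n)
        h₀ = fraction (H₀ n)
    in
    (fraction (H₂ (suc n))
      ≈ (y - 1#) * h₂ ^ 3
        + 1/[x-1] * (6 · h₂ ^ 2 * h₁ + 3 · h₂ * h₁ ^ 2)
        + 3 · h₂ ^ 3 + 6 · h₂ ^ 2 * h₁ + 3 · h₂ * h₁ ^ 2)
    × (fraction (H₁ (suc n))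
      ≈ (y - 1#) * h₂ ^ 2 * h₁
        + 1/[x-1] * (h₂ ^ 2 * h₀ + 7 · h₂ * h₁ ^ 2 + 2 · h₂ * h₁ * h₀ + 4 · h₁ ^ 3 + h₁ ^ 2 * h₀)
        + 7 · h₂ ^ 2 * h₁ + 2 · h₂ ^ 2 * h₀ + 14 · h₂ * h₁ ^ 2 + 4 · h₂ * h₁ * h₀ + 7 · h₁ ^ 3
        + 2 · h₁ ^ 2 * h₀
        + (x - 1#) * (h₂ ^ 3 + 5 · h₂ ^ 2 * h₁ + h₂ ^ 2 * h₀ + 7 · h₂ * h₁ ^ 2 + 2 · h₂ * h₁ * h₀
                      + 3 · h₁ ^ 3 + h₁ ^ 2 * h₀))
    × (fraction (H₀ (suc n))
      ≈ (y - 1#) * (3 · h₂ * h₁ ^ 2 + h₁ ^ 3)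
        + 1/[x-1] * (12 · h₂ * h₁ * h₀ + 3 · h₂ * h₀ ^ 2 + 14 · h₁ ^ 3 + 24 · h₁ ^ 2 * h₀
                     + 9 · h₁ * h₀ ^ 2 + h₀ ^ 3)
        + 3 · h₂ ^ 2 * h₀ + 36 · h₂ * h₁ ^ 2 + 42 · h₂ * h₁ * h₀ + 9 · h₂ * h₀ ^ 2 + 60 · h₁ ^ 3
        + 75 · h₁ ^ 2 * h₀ + 27 · h₁ * h₀ ^ 2 + 3 · h₀ ^ 3
        + (x - 1#) * (12 · h₂ ^ 2 * h₁ + 6 · h₂ ^ 2 * h₀ + 60 · h₂ * h₁ ^ 2 + 48 · h₂ * h₁ * h₀
                      + 9 · h₂ * h₀ ^ 2 + 72 · h₁ ^ 3 + 78 · h₁ ^ 2 * h₀ + 27 · h₁ * h₀ ^ 2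
                      + 3 · h₀ ^ 3)
        + (x - 1#) ^ 2 * (h₂ ^ 3 + 9 · h₂ ^ 2 * h₁ + 3 · h₂ ^ 2 * h₀ + 27 · h₂ * h₁ ^ 2
                          + 18 · h₂ * h₁ * h₀ + 3 · h₂ * h₀ ^ 2 + 27 · h₁ ^ 3 + 27 · h₁ ^ 2 * h₀
                          + 9 · h₁ * h₀ ^ 2 + h₀ ^ 3)))
theorem4p3 =
  (decomposition ,
   decide-≈ (H₂ 1) (y + 2 · 1#) ,
   decide-≈ (H₁ 1) (x - 1#) ,
   decide-≈ (H₀ 1) ((x - 1#) ^ 2)) ,
  λ n → Satisfied.recurrence (recurrence-H n)
  where open ℤ[x,y] using (x; y; _+_; _-_; _·_; _^_; 1#)
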